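{- Consider the Online Matroid Intersection Maintenance problem with a ground set $E$, an arbitrary matroid $\mathcal{M}$ on $E$, and a partition matroid $\mathcal{P}$ on $E$ whose parts $P_1,\dots,P_k$ are revealed online, one part per time step. When each part arrives, run the Shortest Augmenting Path (SAP) algorithm described below. Then the total number of reassignments performed over the whole sequence of arrivals is $O(n\log^2 n)$, where $n$ is the rank of the intersection $\mathcal{M}\cap\mathcal{P}$, i.e. the maximum size of a set independent in both $\mathcal{M}$ and $\mathcal{P}$.
   Context: The partition matroid $\mathcal{P}$ has parts $P_1,\dots,P_k$, each of capacity $1$: a set is independent in $\mathcal{P}$ iff it contains at most one element from each part. Neither matroid is known in advance. At time $i$ the part $P_i$ is revealed, and $E|_i=P_1\cup\dots\cup P_i$ denotes the elements revealed so far. The algorithm must maintain a set $I\subseteq E|_i$ that is a maximum-size common independent set of $\mathcal{M}$ and $\mathcal{P}$ restricted to $E|_i$. To do so it may drop elements from, and add elements to, the current set. A reassignment is a single addition or deletion of an element. SAP algorithm. Let $I$ be the current set just before $P_i$ arrives. The exchange graph $D(I)$ is a directed bipartite graph on node set $I\cup(E|_i\setminus I)$ with these arcs: - an arc $y\to x$, for $y\in I$ and $x\in E|_i\setminus I$, whenever $I-y+x$ is independent in $\mathcal{P}$; - an arc $x\to y$ whenever $I-y+x$ is independent in $\mathcal{M}$. A free element is an $e\notin I$ such that $I+e$ is independent in $\mathcal{M}$. The algorithm finds a shortest directed path in $D(I)$ from some element of $P_i$ to a free element, if such a path exists. It then replaces $I$ by the symmetric difference of $I$ with the vertex set of that path,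 which is an independent set of size $|I|+1$. The cost of the algorithm is the total number of reassignments over all arrivals. -}

module Defs where

open import Level using (0ℓ)
open import Data.Nat using (ℕ; zero; suc; _+_; _*_; _≤_; _<_)
open import Data.Fin using (Fin; toℕ; fromℕ<)
open import Data.Fin.Subset using (Subset; ⁅_⁆; _∈_; _∉_; _⊆_; _∪_; _─_; _-_; ∣_∣; ⊥)
open import Data.List using (List; []; _∷_; length)
open import Data.Product using (Σ; ∃; _×_; _,_)
open import Data.Sum using (_⊎_)
open import Relation.Binary.PropositionalEquality using (_≡_)
open import Relation.Nullary using (¬_)

record Matroid (m : ℕ) : Set₁ where
  field
    Indep    : Subset m → Set
    indep-∅  : Indep ⊥
    indep-⊆  : ∀ {A B} → A ⊆ B → Indep B → Indep A
    exchange : ∀ {A B} → Indep A → Indep B → ∣ A ∣ < ∣ B ∣ →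
               ∃ λ e → e ∈ B × e ∉ A × Indep (A ∪ ⁅ e ⁆)
open Matroid public

-- Partition matroid with k parts of capacity 1.
-- `part x` is the index of the part containing x (parts indexed 0..k-1,
-- part j is revealed at time step j).

PIndep : ∀ {m k} → (Fin m → Fin k) → Subset m → Set
PIndep part A = ∀ x y → x ∈ A → y ∈ A → part x ≡ part y → x ≡ y

CommonIndep : ∀ {m k} → Matroid m → (Fin m → Fin k) → Subset m → Set
CommonIndep M part A = Indep M A × PIndep part A

IsIntersectionRank : ∀ {m k} → Matroid m → (Fin m → Fin k) → ℕ → Set
IsIntersectionRank M part n =
  (∃ λ A → CommonIndep M part A × ∣ A ∣ ≡ n) ×
  (∀ A → CommonIndep M part A → ∣ A ∣ ≤ n)

Revealed : ∀ {m k} → (Fin m → Fin k) → Fin k → Fin m → Set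
Revealed part i x = toℕ (part x) ≤ toℕ i

_+ₛ_ : ∀ {m} → Subset m → Fin m → Subset m
A +ₛ x = A ∪ ⁅ x ⁆

_Δ_ : ∀ {m} → Subset m → Subset m → Subset m
A Δ B = (A ─ B) ∪ (B ─ A)

module _ {m k : ℕ} (M : Matroid m) (part : Fin m → Fin k) (i : Fin k)
         (I : Subset m) where

  Arc : Fin m → Fin m → Set
  Arc u v =
    Revealed part i u × Revealed part i v ×
    ( (u ∈ I × v ∉ I × PIndep part ((I - u) +ₛ v))
    ⊎ (u ∉ I × v ∈ I × Indep M ((I - v) +ₛ u)) )

  Free : Fin m → Set
  Free e = Revealed part i e × e ∉ I × Indep M (I +ₛ e)

  WalkToFree : Fin m → List (Fin m) → Set
  WalkToFree v []       = Free v
  WalkToFree v (w ∷ ws) = Arc v w × WalkToFree w ws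

  AugPath : Fin m → List (Fin m) → Set
  AugPath v vs = part v ≡ i × WalkToFree v vs

  ShortestAugPath : Fin m → List (Fin m) → Set
  ShortestAugPath v vs =
    AugPath v vs × (∀ w ws → AugPath w ws → length vs ≤ length ws)

  vertexSet : Fin m → List (Fin m) → Subset m
  vertexSet v []       = ⁅ v ⁆
  vertexSet v (w ∷ ws) = ⁅ v ⁆ ∪ vertexSet w ws

  SAPStep : Subset m → Set
  SAPStep I' =
    (∃ λ v → ∃ λ vs → ShortestAugPath v vs × I' ≡ I Δ vertexSet v vs)
    ⊎ ((¬ ∃ λ v → ∃ λ vs → AugPath v vs) × I' ≡ I)

-- A full run of SAP: sets I₀ = ∅, I₁, …, I_k, where I_{i+1} is obtained
-- from I_i by an SAP step when part i arrives (any tie-breaking).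

record SAPRun {m k : ℕ} (M : Matroid m) (part : Fin m → Fin k) : Set where
  field
    sets  : ℕ → Subset m
    start : sets 0 ≡ ⊥
    step  : (i : Fin k) → SAPStep M part i (sets (toℕ i)) (sets (suc (toℕ i)))
open SAPRun public

reassignments : ∀ {m k} {M : Matroid m} {part : Fin m → Fin k} →
                SAPRun M part → ℕ → ℕ
reassignments r zero    = 0
reassignments r (suc t) = reassignments r t + ∣ sets r t Δ sets r (suc t) ∣

totalReassignments : ∀ {m k} {M : Matroid m} {part : Fin m → Fin k} →
                     SAPRun M part → ℕ
totalReassignments {k = k} r = reassignments r k

{-# OPTIONS --safe #-}

-- For q = p + 1 let Φ_q be the maximum of q ∣S ∩ I∣ − p rank S over unions S of parts.
-- Since S ∩ I is independent, 0 ≤ Φ_q ≤ ∣I∣ ≤ n, and Φ_q never decreases.  Let S attain the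
-- maximum when a part P arrives, and suppose that some x ∈ P is not spanned by S.  Maximality
-- says that every set of elements of I outside S has parts whose rank over S is at least q/p
-- times as large, so the elements of I outside S that are reached from x grow by the factor
-- q/p in each double step, until a free element is met.  As ((p + 1)/p)^q ≥ 2, this happens
-- within q L double steps if 2^L > n.  Hence a path of length more than 2 q L means that S
-- spans P; then S ∪ P shows that Φ_q grows by q.  So at most n/q paths are longer than 2 q L,
-- and summing over q = 2^a with a < L bounds the total length by O(n L²).
--
-- Independence in M and reachability are not decidable, but the claimed inequality is, so
-- both may be decided under a double negation.

module Submission where

open import Defs
open import Level using ()
open import Data.Nat using (ℕ; zero; suc; _+_; _*_; _∸_; _^_; _⊓_; _≤_; _<_; z≤n; s≤s; _≤?_; _<?_; NonZero)
open import Data.Nat.Properties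
open import Data.Nat.Logarithm using (⌈log₂_⌉; ⌈log₂⌉-mono-≤; ⌈log₂2^n⌉≡n)
open import Data.Nat.Tactic.RingSolver using (solve-∀)
open import Data.Nat.ListAction using (sum)
open import Data.Bool using (true; false)
open import Data.Fin using (Fin; zero; suc; toℕ; fromℕ<)
open import Data.Fin.Properties using (any?; all?; toℕ-fromℕ<; toℕ-injective; sequence) renaming (_≟_ to _≟F_)
open import Data.Fin.Subset using (Subset; ⁅_⁆; _∈_; _∉_; _⊆_; _∩_; _∪_; _─_; _-_; ∣_∣; ⊥) renaming (⊤ to full)
open import Data.Fin.Subset.Properties
open import Data.List using (List; []; _∷_; length; map)
open import Data.Vec using ([]; _∷_; here; there; tabulate)
open import Data.Vec.Properties using (lookup⇒[]=; []=⇒lookup; lookup∘tabulate)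
open import Data.Product using (∃; _×_; _,_; proj₁; proj₂)
open import Data.Sum using (_⊎_; inj₁; inj₂; [_,_]′)
open import Function using (_∘_; case_of_)
open import Relation.Binary.PropositionalEquality
open import Relation.Nullary using (¬_; Dec; yes; no; does; contradiction)
open import Relation.Nullary.Decidable using (¬?; _×-dec_; _→-dec_; _⊎-dec_; decidable-stable; ¬¬-excluded-middle; dec-true; toSum)
open import Relation.Nullary.Negation using (¬¬-Monad)
open import Relation.Unary using (Decidable)
open import Data.Unit using (⊤; tt)
open import Effect.Monad using (RawMonad)

-- Finite subsets

∈-+ₛˡ : ∀ {m} {A : Subset m} {x z} → z ∈ A → z ∈ A +ₛ x
∈-+ₛˡ z∈A = x∈p∪q⁺ (inj₁ z∈A)

∈-+ₛʳ : ∀ {m} {A : Subset m} {x} → x ∈ A +ₛ x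
∈-+ₛʳ {x = x} = x∈p∪q⁺ (inj₂ (x∈⁅x⁆ x))

∈-+ₛ⁻ : ∀ {m} {A : Subset m} {x z} → z ∈ A +ₛ x → z ∈ A ⊎ z ≡ x
∈-+ₛ⁻ {A = A} {x} z∈ with x∈p∪q⁻ A ⁅ x ⁆ z∈
... | inj₁ z∈A = inj₁ z∈A
... | inj₂ z∈x = inj₂ (x∈⁅y⁆⇒x≡y x z∈x)

∈-─⁻ : ∀ {m} (A B : Subset m) {z} → z ∈ A ─ B → z ∈ A × z ∉ B
∈-─⁻ (true ∷ A)  (false ∷ B) here      = here , λ ()
∈-─⁻ (false ∷ A) (true ∷ B)  {zero} ()
∈-─⁻ (false ∷ A) (false ∷ B) {zero} ()
∈-─⁻ (a ∷ A)     (b ∷ B)     (there p) with ∈-─⁻ A B p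
... | z∈A , z∉B = there z∈A , λ { (there z∈B) → z∉B z∈B }

+ₛ-mono : ∀ {m} {A B : Subset m} {x} → A ⊆ B → A +ₛ x ⊆ B +ₛ x
+ₛ-mono {A = A} {B} A⊆B z∈ with ∈-+ₛ⁻ {A = A} z∈
... | inj₁ z∈A  = ∈-+ₛˡ (A⊆B z∈A)
... | inj₂ refl = ∈-+ₛʳ {A = B}

∈-minus⁻ : ∀ {m} {A : Subset m} {y z} → z ∈ A - y → z ∈ A × z ≢ y
∈-minus⁻ {A = A} {y} z∈ with ∈-─⁻ A ⁅ y ⁆ z∈
... | z∈A , z∉y = z∈A , λ { refl → z∉y (x∈⁅x⁆ y) }

∈-minus⁺ : ∀ {m} {A : Subset m} {y z} → z ∈ A → z ≢ y → z ∈ A - y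
∈-minus⁺ = x∈p∧x≢y⇒x∈p-y

∈-Δ⁺ : ∀ {m} {A B : Subset m} {z} → (z ∈ A × z ∉ B) ⊎ (z ∈ B × z ∉ A) → z ∈ A Δ B
∈-Δ⁺ (inj₁ (a , b)) = x∈p∪q⁺ (inj₁ (x∈p∧x∉q⇒x∈p─q a b))
∈-Δ⁺ (inj₂ (a , b)) = x∈p∪q⁺ (inj₂ (x∈p∧x∉q⇒x∈p─q a b))

∈-Δ⁻ : ∀ {m} {A B : Subset m} {z} → z ∈ A Δ B → (z ∈ A × z ∉ B) ⊎ (z ∈ B × z ∉ A)
∈-Δ⁻ {A = A} {B} z∈ with x∈p∪q⁻ (A ─ B) (B ─ A) z∈
... | inj₁ p = inj₁ (∈-─⁻ A B p)
... | inj₂ p = inj₂ (∈-─⁻ B A p)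

comprehension : ∀ {m} {P : Fin m → Set} → Decidable P → Subset m
comprehension P? = tabulate (λ x → does (P? x))

∈-comprehension⁺ : ∀ {m} {P : Fin m → Set} (P? : Decidable P) {x} → P x → x ∈ comprehension P?
∈-comprehension⁺ P? {x} px =
  lookup⇒[]= x _ (trans (lookup∘tabulate _ x) (dec-true (P? x) px))

∈-comprehension⁻ : ∀ {m} {P : Fin m → Set} (P? : Decidable P) {x} → x ∈ comprehension P? → P x
∈-comprehension⁻ P? {x} x∈ with P? x | trans (sym (lookup∘tabulate (λ z → does (P? z)) x)) ([]=⇒lookup x∈)
... | yes px | _ = px
... | no _ | ()

∣A∣≡∣A∩B∣+∣A─B∣ : ∀ {m} (A B : Subset m) → ∣ A ∣ ≡ ∣ A ∩ B ∣ + ∣ A ─ B ∣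
∣A∣≡∣A∩B∣+∣A─B∣ []          []          = refl
∣A∣≡∣A∩B∣+∣A─B∣ (true ∷ A)  (true ∷ B)  = cong suc (∣A∣≡∣A∩B∣+∣A─B∣ A B)
∣A∣≡∣A∩B∣+∣A─B∣ (true ∷ A)  (false ∷ B) =
  trans (cong suc (∣A∣≡∣A∩B∣+∣A─B∣ A B)) (sym (+-suc _ _))
∣A∣≡∣A∩B∣+∣A─B∣ (false ∷ A) (true ∷ B)  = ∣A∣≡∣A∩B∣+∣A─B∣ A B
∣A∣≡∣A∩B∣+∣A─B∣ (false ∷ A) (false ∷ B) = ∣A∣≡∣A∩B∣+∣A─B∣ A B

∣A∪B∣≤∣A∣+∣B∣ : ∀ {m} (A B : Subset m) → ∣ A ∪ B ∣ ≤ ∣ A ∣ + ∣ B ∣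
∣A∪B∣≤∣A∣+∣B∣ []          []          = z≤n
∣A∪B∣≤∣A∣+∣B∣ (true ∷ A)  (true ∷ B)  =
  s≤s (≤-trans (∣A∪B∣≤∣A∣+∣B∣ A B) (+-monoʳ-≤ ∣ A ∣ (n≤1+n _)))
∣A∪B∣≤∣A∣+∣B∣ (true ∷ A)  (false ∷ B) = s≤s (∣A∪B∣≤∣A∣+∣B∣ A B)
∣A∪B∣≤∣A∣+∣B∣ (false ∷ A) (true ∷ B)  =
  ≤-trans (s≤s (∣A∪B∣≤∣A∣+∣B∣ A B)) (≤-reflexive (sym (+-suc _ _)))
∣A∪B∣≤∣A∣+∣B∣ (false ∷ A) (false ∷ B) = ∣A∪B∣≤∣A∣+∣B∣ A B

∣A+x∣≤1+∣A∣ : ∀ {m} (A : Subset m) x → ∣ A +ₛ x ∣ ≤ suc ∣ A ∣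
∣A+x∣≤1+∣A∣ A x = ≤-trans (∣A∪B∣≤∣A∣+∣B∣ A ⁅ x ⁆)
  (≤-reflexive (trans (cong (∣ A ∣ +_) (∣⁅x⁆∣≡1 x)) (+-comm ∣ A ∣ 1)))

A⊆B∧x∉A⇒∣A∣<∣B∣ : ∀ {m} {A B : Subset m} {x} → A ⊆ B → x ∈ B → x ∉ A → ∣ A ∣ < ∣ B ∣
A⊆B∧x∉A⇒∣A∣<∣B∣ A⊆B x∈B x∉A = p⊂q⇒∣p∣<∣q∣ (A⊆B , _ , x∈B , x∉A)

∣A+x∣≡1+∣A∣ : ∀ {m} {A : Subset m} {x} → x ∉ A → ∣ A +ₛ x ∣ ≡ suc ∣ A ∣
∣A+x∣≡1+∣A∣ {A = A} {x} x∉A =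
  ≤-antisym (∣A+x∣≤1+∣A∣ A x) (A⊆B∧x∉A⇒∣A∣<∣B∣ ∈-+ₛˡ ∈-+ₛʳ x∉A)

A⊆A-y+y : ∀ {m} {A : Subset m} y → A ⊆ (A - y) +ₛ y
A⊆A-y+y y {z} z∈A with z ≟F y
... | yes refl = ∈-+ₛʳ
... | no z≢y   = ∈-+ₛˡ (∈-minus⁺ z∈A z≢y)

swap-∣∣-≤ : ∀ {m} {A B : Subset m} {x y} →
            A - y ⊆ B → x ∈ B → x ∉ A → ∣ A ∣ ≤ ∣ B ∣
swap-∣∣-≤ {A = A} {B} {x} {y} A-y⊆B x∈B x∉A = begin
  ∣ A ∣              ≤⟨ p⊆q⇒∣p∣≤∣q∣ (A⊆A-y+y {A = A} y) ⟩
  ∣ (A - y) +ₛ y ∣   ≤⟨ ∣A+x∣≤1+∣A∣ (A - y) y ⟩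
  suc ∣ A - y ∣      ≤⟨ A⊆B∧x∉A⇒∣A∣<∣B∣ A-y⊆B x∈B (x∉A ∘ proj₁ ∘ ∈-minus⁻) ⟩
  ∣ B ∣              ∎
  where open ≤-Reasoning

A⊆B∧∣B∣≤∣A∣⇒B⊆A : ∀ {m} {A B : Subset m} → A ⊆ B → ∣ B ∣ ≤ ∣ A ∣ → B ⊆ A
A⊆B∧∣B∣≤∣A∣⇒B⊆A {A = A} A⊆B B≤A {x} x∈B with x ∈? A
... | yes x∈A = x∈A
... | no x∉A  = contradiction (A⊆B∧x∉A⇒∣A∣<∣B∣ A⊆B x∈B x∉A) (≤⇒≯ B≤A)

-- Hill climbing: every move raises `f` by at least one, so `gap`, which bounds the distance from
-- `f A` up to `b`, serves as fuel.
argmax : ∀ {m} {P : Subset m → Set} → Decidable P → (f : Subset m → ℕ) (b : ℕ) → (∀ A → f A ≤ b) →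
         ∃ P → ∃ λ A → P A × (∀ B → P B → f B ≤ f A)
argmax {m} {P} P? f b f≤b (A₀ , pA₀) = climb b A₀ pA₀ (m≤n+m b (f A₀))
  where
  climb : ∀ gap A → P A → b ≤ f A + gap → ∃ λ A → P A × (∀ B → P B → f B ≤ f A)
  climb gap A pA b≤ with anySubset? (λ B → P? B ×-dec (f A <? f B))
  ... | no none = A , pA , λ B pB → ≮⇒≥ (λ fA<fB → none (B , pB , fA<fB))
  climb zero A pA b≤ | yes (B , pB , fA<fB) =
    contradiction (≤-trans fA<fB (≤-trans (f≤b B) (≤-trans b≤ (≤-reflexive (+-identityʳ _))))) (<-irrefl refl)
  climb (suc gap) A pA b≤ | yes (B , pB , fA<fB) =
    climb gap B pB (≤-trans (≤-trans b≤ (≤-reflexive (+-suc _ gap))) (+-monoˡ-≤ gap fA<fB))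

-- Double negation over finite families

module ¬¬ = RawMonad (¬¬-Monad {Level.zero})

-- Only finitely many subsets exist, so the double negation can be pulled out one coordinate at a
-- time. This makes independence decidable for all subsets at once.
¬¬-Subset : ∀ {m} {P : Subset m → Set} → (∀ A → ¬ ¬ P A) → ¬ ¬ (∀ A → P A)
¬¬-Subset {zero}  h k = h [] (λ p → k λ { [] → p })
¬¬-Subset {suc m} h k =
  ¬¬-Subset (λ A → h (true ∷ A)) λ t → ¬¬-Subset (λ A → h (false ∷ A)) λ f →
  k λ { (true ∷ A) → t A ; (false ∷ A) → f A }

-- Span and rank

module MatroidTheory {m} (M : Matroid m) (indep? : Decidable (Indep M)) where

  extend : ∀ {A B} → Indep M A → Indep M B → ∣ A ∣ ≤ ∣ B ∣ →
           ∃ λ C → Indep M C × A ⊆ C × C ⊆ A ∪ B × ∣ C ∣ ≡ ∣ B ∣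
  extend {A₀} {B} iA₀ iB A₀≤B =
    grow (∣ B ∣ ∸ ∣ A₀ ∣) A₀ iA₀ (λ z → z) (p⊆p∪q B) (m+[n∸m]≡n A₀≤B)
    where
    grow : ∀ gap A → Indep M A → A₀ ⊆ A → A ⊆ A₀ ∪ B → ∣ A ∣ + gap ≡ ∣ B ∣ →
           ∃ λ C → Indep M C × A₀ ⊆ C × C ⊆ A₀ ∪ B × ∣ C ∣ ≡ ∣ B ∣
    grow zero A iA A₀⊆A A⊆ eq = A , iA , A₀⊆A , A⊆ , trans (sym (+-identityʳ _)) eq
    grow (suc gap) A iA A₀⊆A A⊆ eq
      with exchange M iA iB (≤-trans (s≤s (m≤m+n _ gap)) (≤-reflexive (trans (sym (+-suc _ gap)) eq)))
    ... | e , e∈B , e∉A , iA+e =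
      grow gap (A +ₛ e) iA+e (λ z → ∈-+ₛˡ {A = A} (A₀⊆A z))
        (λ z∈ → case ∈-+ₛ⁻ {A = A} z∈ of λ
          { (inj₁ z∈A) → A⊆ z∈A ; (inj₂ refl) → q⊆p∪q A₀ B e∈B })
        (trans (cong (_+ gap) (∣A+x∣≡1+∣A∣ e∉A)) (trans (sym (+-suc _ gap)) eq))

  -- The circuit C(J, x) is not contained in the independent set A + x, and J + x becomes
  -- independent after the removal of any z ∈ C(J, x).
  circuit-leaves : ∀ {J A x} → Indep M J → x ∉ J → A ⊆ J → ¬ Indep M (J +ₛ x) → Indep M (A +ₛ x) →
                   ∃ λ z → z ∈ J × z ∉ A × Indep M ((J - z) +ₛ x)
  circuit-leaves {J} {A} {x} iJ x∉J A⊆J dJ+x iA+x with ∣ A +ₛ x ∣ ≤? ∣ J ∣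
  ... | no A+x≰J with exchange M iJ iA+x (≰⇒> A+x≰J)
  ...   | e , e∈A+x , e∉J , iJ+e with ∈-+ₛ⁻ {A = A} e∈A+x
  ...     | inj₁ e∈A  = contradiction (A⊆J e∈A) e∉J
  ...     | inj₂ refl = contradiction iJ+e dJ+x
  circuit-leaves {J} {A} {x} iJ x∉J A⊆J dJ+x iA+x | yes A+x≤J with extend iA+x iJ A+x≤J
  ... | C , iC , A+x⊆C , C⊆ , ∣C∣≡∣J∣ with any? (λ z → (z ∈? J) ×-dec ¬? (z ∈? C))
  ...   | yes (z , z∈J , z∉C) = z , z∈J , (λ z∈A → z∉C (A+x⊆C (∈-+ₛˡ {A = A} z∈A))) ,
          indep-⊆ M (A⊆B∧∣B∣≤∣A∣⇒B⊆A C⊆J-z+x J-z+x≤C) iC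
    where
    C⊆J-z+x : C ⊆ (J - z) +ₛ x
    C⊆J-z+x {w} w∈C with x∈p∪q⁻ (A +ₛ x) J (C⊆ w∈C)
    ... | inj₂ w∈J = ∈-+ₛˡ (∈-minus⁺ w∈J λ { refl → z∉C w∈C })
    ... | inj₁ w∈A+x with ∈-+ₛ⁻ {A = A} w∈A+x
    ...   | inj₁ w∈A  = ∈-+ₛˡ (∈-minus⁺ (A⊆J w∈A) λ { refl → z∉C w∈C })
    ...   | inj₂ refl = ∈-+ₛʳ {A = J - z}
    J-z+x≤C : ∣ (J - z) +ₛ x ∣ ≤ ∣ C ∣
    J-z+x≤C = ≤-trans (∣A+x∣≤1+∣A∣ (J - z) x)
      (≤-trans (x∈p⇒∣p-x∣<∣p∣ z∈J) (≤-reflexive (sym ∣C∣≡∣J∣)))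
  ...   | no none = contradiction (indep-⊆ M J+x⊆C iC) dJ+x
    where
    J+x⊆C : J +ₛ x ⊆ C
    J+x⊆C {w} w∈ with ∈-+ₛ⁻ {A = J} w∈
    ... | inj₂ refl = A+x⊆C (∈-+ₛʳ {A = A})
    ... | inj₁ w∈J with w ∈? C
    ...   | yes w∈C = w∈C
    ...   | no w∉C  = contradiction (w , w∈J , w∉C) none

  -- As `A +ₛ x` is already dependent, the circuit that `x` closes in `J` lies inside it. An
  -- exchange that breaks this circuit in `A` therefore also breaks it in `J`.
  swap-indep : ∀ {J A x y} → Indep M J → x ∉ J → A ⊆ J → y ∈ A →
               ¬ Indep M (A +ₛ x) → Indep M ((A - y) +ₛ x) → Indep M ((J - y) +ₛ x)
  swap-indep {J} {A} {x} {y} iJ x∉J A⊆J y∈A dA+x iA-y+x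
    with circuit-leaves iJ x∉J (A⊆J ∘ proj₁ ∘ ∈-minus⁻) (dA+x ∘ indep-⊆ M (+ₛ-mono A⊆J)) iA-y+x
  ... | z , z∈J , z∉A-y , iJ-z+x with z ≟F y
  ...   | yes refl = iJ-z+x
  ...   | no z≢y   = contradiction (indep-⊆ M A+x⊆J-z+x iJ-z+x) dA+x
    where
    A+x⊆J-z+x : A +ₛ x ⊆ (J - z) +ₛ x
    A+x⊆J-z+x w∈ with ∈-+ₛ⁻ {A = A} w∈
    ... | inj₁ w∈A  = ∈-+ₛˡ (∈-minus⁺ (A⊆J w∈A) λ { refl → z∉A-y (∈-minus⁺ w∈A z≢y) })
    ... | inj₂ refl = ∈-+ₛʳ {A = J - z}

  -- Matroid closure, witnessed by a single independent subset, so that membership can be shown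
  -- without reference to a basis of `S`.
  Spanned : Subset m → Fin m → Set
  Spanned S x = x ∈ S ⊎ ∃ λ A → A ⊆ S × Indep M A × ¬ Indep M (A +ₛ x)

  basis : ∀ S → ∃ λ B → (Indep M B × B ⊆ S) × (∀ C → Indep M C × C ⊆ S → ∣ C ∣ ≤ ∣ B ∣)
  basis S = argmax (λ B → indep? B ×-dec (B ⊆? S)) ∣_∣ m ∣p∣≤n (⊥ , indep-∅ M , ⊥⊆)

  rank : Subset m → ℕ
  rank S = ∣ proj₁ (basis S) ∣

  indep⇒≤rank : ∀ {C S} → Indep M C → C ⊆ S → ∣ C ∣ ≤ rank S
  indep⇒≤rank {C} {S} iC C⊆S = proj₂ (proj₂ (basis S)) C (iC , C⊆S)

  rank≤m : ∀ S → rank S ≤ m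
  rank≤m S = ∣p∣≤n (proj₁ (basis S))

  -- If `x` could be added to the basis `B`, the witness `A` would extend inside `A ∪ (B +ₛ x)` to
  -- an independent `C` of size `∣ B ∣ + 1`. Either `C` contains `x`, which contradicts the
  -- dependence of `A +ₛ x`, or `C` is a subset of `S` larger than its basis.
  spanned⇒basis-dependent : ∀ {S x} → Spanned S x → x ∉ proj₁ (basis S) →
                            ¬ Indep M (proj₁ (basis S) +ₛ x)
  spanned⇒basis-dependent {S} {x} sp x∉B iB+x with basis S
  ... | B , (iB , B⊆S) , maxB with sp
  ...   | inj₁ x∈S = <-irrefl refl (≤-trans (≤-reflexive (sym (∣A+x∣≡1+∣A∣ x∉B)))
            (maxB (B +ₛ x) (iB+x , λ w∈ → case ∈-+ₛ⁻ {A = B} w∈ of λ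
              { (inj₁ w∈B) → B⊆S w∈B ; (inj₂ refl) → x∈S })))
  ...   | inj₂ (A , A⊆S , iA , dA+x)
    with extend iA iB+x (≤-trans (maxB A (iA , A⊆S)) (≤-trans (n≤1+n _) (≤-reflexive (sym (∣A+x∣≡1+∣A∣ x∉B)))))
  ...     | C , iC , A⊆C , C⊆ , ∣C∣≡ with x ∈? C
  ...       | yes x∈C = dA+x (indep-⊆ M (λ w∈ → case ∈-+ₛ⁻ {A = A} w∈ of λ
                { (inj₁ w∈A) → A⊆C w∈A ; (inj₂ refl) → x∈C }) iC)
  ...       | no x∉C  = <-irrefl refl (≤-trans (≤-reflexive (trans (sym (∣A+x∣≡1+∣A∣ x∉B)) (sym ∣C∣≡))) (maxB C (iC , C⊆S)))
    where
    C⊆S : C ⊆ S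
    C⊆S {w} w∈C with x∈p∪q⁻ A (B +ₛ x) (C⊆ w∈C)
    ... | inj₁ w∈A = A⊆S w∈A
    ... | inj₂ w∈B+x with ∈-+ₛ⁻ {A = B} w∈B+x
    ...   | inj₁ w∈B  = B⊆S w∈B
    ...   | inj₂ refl = contradiction w∈C x∉C

  -- A larger basis of `X` would pass some element to the basis of `S` by exchange, but that element
  -- is spanned by `S`.
  spanned⇒rank≤ : ∀ {X S} → (∀ {x} → x ∈ X → Spanned S x) → rank X ≤ rank S
  spanned⇒rank≤ {X} {S} sp with rank X ≤? rank S
  ... | yes X≤S = X≤S
  ... | no X≰S
    with exchange M (proj₁ (proj₁ (proj₂ (basis S)))) (proj₁ (proj₁ (proj₂ (basis X)))) (≰⇒> X≰S)
  ...   | e , e∈BX , e∉BS , iBS+e =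
    contradiction iBS+e (spanned⇒basis-dependent (sp (proj₂ (proj₁ (proj₂ (basis X))) e∈BX)) e∉BS)

  rank-∪-≤ : ∀ S Z → rank (S ∪ Z) ≤ rank S + ∣ Z ─ S ∣
  rank-∪-≤ S Z with basis (S ∪ Z)
  ... | B , (iB , B⊆) , _ = begin
    ∣ B ∣                    ≡⟨ ∣A∣≡∣A∩B∣+∣A─B∣ B S ⟩
    ∣ B ∩ S ∣ + ∣ B ─ S ∣    ≤⟨ +-mono-≤ (indep⇒≤rank (indep-⊆ M (p∩q⊆p B S) iB) (p∩q⊆q B S)) (p⊆q⇒∣p∣≤∣q∣ B─S⊆Z─S) ⟩
    rank S + ∣ Z ─ S ∣       ∎
    where
    open ≤-Reasoning
    B─S⊆Z─S : B ─ S ⊆ Z ─ S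
    B─S⊆Z─S {w} w∈ with ∈-─⁻ B S w∈
    ... | w∈B , w∉S with x∈p∪q⁻ S Z (B⊆ w∈B)
    ...   | inj₁ w∈S = contradiction w∈S w∉S
    ...   | inj₂ w∈Z = x∈p∧x∉q⇒x∈p─q w∈Z w∉S

-- Exchange graphs

PartClosed : ∀ {m k} → (Fin m → Fin k) → Subset m → Set
PartClosed part S = ∀ x y → x ∈ S → part x ≡ part y → y ∈ S

PIndep? : ∀ {m k} (part : Fin m → Fin k) → Decidable (PIndep part)
PIndep? part A = all? λ x → all? λ y →
  (x ∈? A) →-dec ((y ∈? A) →-dec ((part x ≟F part y) →-dec (x ≟F y)))

PIndep-swap : ∀ {m k} {part : Fin m → Fin k} {A x y} →
              PIndep part A → y ∈ A → part x ≡ part y → PIndep part ((A - y) +ₛ x)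
PIndep-swap {A = A} {x} {y} pA y∈A px≡py a b a∈ b∈ pa≡pb
  with ∈-+ₛ⁻ {A = A - y} a∈ | ∈-+ₛ⁻ {A = A - y} b∈
... | inj₁ a∈A-y | inj₁ b∈A-y = pA a b (proj₁ (∈-minus⁻ a∈A-y)) (proj₁ (∈-minus⁻ b∈A-y)) pa≡pb
... | inj₂ refl  | inj₂ refl  = refl
... | inj₁ a∈A-y | inj₂ refl  with ∈-minus⁻ a∈A-y
...   | a∈A , a≢y = contradiction (pA a y a∈A y∈A (trans pa≡pb px≡py)) a≢y
PIndep-swap {A = A} {x} {y} pA y∈A px≡py a b a∈ b∈ pa≡pb | inj₂ refl | inj₁ b∈A-y with ∈-minus⁻ b∈A-y
... | b∈A , b≢y = contradiction (pA b y b∈A y∈A (trans (sym pa≡pb) px≡py)) b≢y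

PIndep-add : ∀ {m k} {part : Fin m → Fin k} {A x} →
             PIndep part A → (∀ z → z ∈ A → part z ≢ part x) → PIndep part (A +ₛ x)
PIndep-add {A = A} pA unhit a b a∈ b∈ pa≡pb with ∈-+ₛ⁻ {A = A} a∈ | ∈-+ₛ⁻ {A = A} b∈
... | inj₁ a∈A  | inj₁ b∈A  = pA a b a∈A b∈A pa≡pb
... | inj₁ a∈A  | inj₂ refl = contradiction pa≡pb (unhit a a∈A)
... | inj₂ refl | inj₁ b∈A  = contradiction (sym pa≡pb) (unhit b b∈A)
... | inj₂ refl | inj₂ refl = refl

-- `dead` collects the elements that lost all access to free elements when some
-- part could not be matched; no later shortest augmenting path meets it.
record Sound {m k} (M : Matroid m) (part : Fin m → Fin k) (t : ℕ) (I : Subset m) : Set where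
  field
    indep      : Indep M I
    pindep     : PIndep part I
    early      : ∀ {x} → x ∈ I → toℕ (part x) < t
    dead       : Subset m
    dead-unhit : ∀ {x} → toℕ (part x) < t → (∀ z → z ∈ I → part z ≢ part x) → x ∈ dead
    dead-span  : ∀ {x} → x ∈ dead → x ∉ I → ¬ Indep M ((I ∩ dead) +ₛ x)
    dead-mate  : ∀ {x y} → y ∈ dead → y ∈ I → x ∉ I → part x ≡ part y → x ∈ dead

module ExchangeGraph {m k} (M : Matroid m) (indep? : Decidable (Indep M)) (part : Fin m → Fin k)
                     (i : Fin k) (I : Subset m) (sound : Sound M part (toℕ i) I) where

  open MatroidTheory M indep?
  open Sound sound

  private
    _⟶_ : Fin m → Fin m → Set
    _⟶_ = Arc M part i I

    IsFree : Fin m → Set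
    IsFree = Free M part i I

    Walk : Fin m → List (Fin m) → Set
    Walk = WalkToFree M part i I

    Aug : Fin m → List (Fin m) → Set
    Aug = AugPath M part i I

    Seen : Fin m → Set
    Seen = Revealed part i

    Vertices : Fin m → List (Fin m) → Subset m
    Vertices = vertexSet M part i I

  seen-I : ∀ {y} → y ∈ I → Seen y
  seen-I y∈I = <⇒≤ (early y∈I)

  new⇒∉I : ∀ {x} → part x ≡ i → x ∉ I
  new⇒∉I px≡i x∈I = <-irrefl (cong toℕ px≡i) (early x∈I)

  seen? : Decidable Seen
  seen? x = toℕ (part x) ≤? toℕ i

  arc? : ∀ u v → Dec (u ⟶ v)
  arc? u v = seen? u ×-dec seen? v ×-dec
    (((u ∈? I) ×-dec ¬? (v ∈? I) ×-dec PIndep? part ((I - u) +ₛ v)) ⊎-dec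
     (¬? (u ∈? I) ×-dec (v ∈? I) ×-dec indep? ((I - v) +ₛ u)))

  free? : Decidable IsFree
  free? x = seen? x ×-dec ¬? (x ∈? I) ×-dec indep? (I +ₛ x)

  -- A lower bound `e` on the distance from `u` to the free elements. The recursion over arcs keeps
  -- it decidable, whereas the existence of a walk of unbounded length is not decided here.
  Far : ℕ → Fin m → Set
  Far zero    u = ⊤
  Far (suc e) u = ¬ IsFree u × (∀ v → u ⟶ v → Far e v)

  far? : ∀ e u → Dec (Far e u)
  far? zero    u = yes tt
  far? (suc e) u = ¬? (free? u) ×-dec all? (λ v → arc? u v →-dec far? e v)

  walks-long⇒far : ∀ e {u} → (∀ ws → Walk u ws → e ≤ length ws) → Far e u
  walks-long⇒far zero    long = tt
  walks-long⇒far (suc e) long =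
    (λ free → case long [] free of λ ()) ,
    λ v u⟶v → walks-long⇒far e λ ws walk → ≤-pred (long (v ∷ ws) (u⟶v , walk))

  far⇒walk-long : ∀ e {u} ws → Far e u → Walk u ws → e ≤ length ws
  far⇒walk-long zero    ws       far         walk         = z≤n
  far⇒walk-long (suc e) []       (¬free , _) free         = contradiction free ¬free
  far⇒walk-long (suc e) (v ∷ ws) (_ , far)   (u⟶v , walk) = s≤s (far⇒walk-long e ws (far v u⟶v) walk)

  far-pred : ∀ e {u} → Far (suc e) u → Far e u
  far-pred zero    far           = tt
  far-pred (suc e) (¬free , far) = ¬free , λ v u⟶v → far-pred e (far v u⟶v)

  far-mono : ∀ {d e u} → d ≤ e → Far e u → Far d u
  far-mono {zero}          d≤e       far           = tt
  far-mono {suc d} {suc e} (s≤s d≤e) (¬free , far) = ¬free , λ v u⟶v → far-mono d≤e (far v u⟶v)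

  mate-arc : ∀ {x y} → y ∈ I → x ∉ I → part x ≡ part y → y ⟶ x
  mate-arc {x} {y} y∈I x∉I px≡py =
    seen-I y∈I , subst (λ j → toℕ j ≤ toℕ i) (sym px≡py) (seen-I y∈I) ,
    inj₁ (y∈I , x∉I , PIndep-swap pindep y∈I px≡py)

  circuit-arc : ∀ {x y} → Seen x → x ∉ I → y ∈ I → Indep M ((I - y) +ₛ x) → x ⟶ y
  circuit-arc sx x∉I y∈I iI-y+x = sx , seen-I y∈I , inj₂ (x∉I , y∈I , iI-y+x)

  -- The circuit that a non-free `x` closes in `I` consists of `x` and its out-neighbours, so any
  -- `A` that holds all out-neighbours contains the rest of the circuit.
  blocked⇒dependent : ∀ {x A} → Seen x → x ∉ I → ¬ IsFree x → A ⊆ I →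
                      (∀ {y} → y ∈ I → x ⟶ y → y ∈ A) → ¬ Indep M (A +ₛ x)
  blocked⇒dependent sx x∉I ¬free A⊆I closed iA+x
    with circuit-leaves indep x∉I A⊆I (λ iI+x → ¬free (sx , x∉I , iI+x)) iA+x
  ... | z , z∈I , z∉A , iI-z+x = z∉A (closed z∈I (circuit-arc sx x∉I z∈I iI-z+x))

  -- Arcs defined through the partition matroid may also enter parts that `I` misses. The two cases
  -- are separated because shortest paths use only the first.
  mate-or-unhit : ∀ {u v} → u ∈ I → v ∉ I → PIndep part ((I - u) +ₛ v) →
                  part v ≡ part u ⊎ (∀ z → z ∈ I → part z ≢ part v)
  mate-or-unhit {u} {v} u∈I v∉I p with part v ≟F part u
  ... | yes pv≡pu = inj₁ pv≡pu
  ... | no pv≢pu  = inj₂ λ z z∈I pz≡pv → v∉I (subst (_∈ I)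
    (p z v (∈-+ₛˡ (∈-minus⁺ z∈I λ { refl → pv≢pu (sym pz≡pv) })) (∈-+ₛʳ {A = I - u}) pz≡pv) z∈I)

  unhit⇒dead-or-new : ∀ {v} → Seen v → (∀ z → z ∈ I → part z ≢ part v) → v ∈ dead ⊎ part v ≡ i
  unhit⇒dead-or-new sv unhit with m≤n⇒m<n∨m≡n sv
  ... | inj₁ pv<i = inj₁ (dead-unhit pv<i unhit)
  ... | inj₂ pv≡i = inj₂ (toℕ-injective pv≡i)

  -- By `dead-span` no element of `dead` is free and matroid arcs from `dead` stay there; by
  -- `dead-mate` and `dead-unhit` so do the other arcs, unless they enter the new part. A walk from
  -- `dead` to a free element thus visits the new part, and its remainder is a strictly shorter
  -- augmenting path.
  escape-dead : ∀ {u} ws → u ∈ dead → Walk u ws → ∃ λ w → ∃ λ ws′ → Aug w ws′ × length ws′ < length ws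
  escape-dead [] u∈D (_ , u∉I , iI+u) =
    contradiction (indep-⊆ M (+ₛ-mono (p∩q⊆p I dead)) iI+u) (dead-span u∈D u∉I)
  escape-dead {u} (v ∷ ws) u∈D ((_ , sv , inj₁ (u∈I , v∉I , p)) , walk)
    with mate-or-unhit u∈I v∉I p
  ... | inj₁ pv≡pu with escape-dead ws (dead-mate u∈D u∈I v∉I pv≡pu) walk
  ...   | w , ws′ , aug , shorter = w , ws′ , aug , m≤n⇒m≤1+n shorter
  escape-dead {u} (v ∷ ws) u∈D ((_ , sv , inj₁ (u∈I , v∉I , p)) , walk) | inj₂ unhit
    with unhit⇒dead-or-new sv unhit
  ... | inj₂ pv≡i = v , ws , (pv≡i , walk) , ≤-refl
  ... | inj₁ v∈D with escape-dead ws v∈D walk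
  ...   | w , ws′ , aug , shorter = w , ws′ , aug , m≤n⇒m≤1+n shorter
  escape-dead {u} (v ∷ ws) u∈D ((_ , sv , inj₂ (u∉I , v∈I , iI-v+u)) , walk) with v ∈? dead
  ... | no v∉D = contradiction (indep-⊆ M (+ₛ-mono I∩D⊆I-v) iI-v+u) (dead-span u∈D u∉I)
    where
    I∩D⊆I-v : I ∩ dead ⊆ I - v
    I∩D⊆I-v w∈ with x∈p∩q⁻ I dead w∈
    ... | w∈I , w∈D = ∈-minus⁺ w∈I λ { refl → v∉D w∈D }
  ... | yes v∈D with escape-dead ws v∈D walk
  ...   | w , ws′ , aug , shorter = w , ws′ , aug , m≤n⇒m≤1+n shorter

  -- Augmentation along a shortest path

  -- The last component compares with augmenting paths from every element of the new part. In this
  -- form the property passes to suffixes and excludes detours through the new part.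
  Geodesic : Fin m → List (Fin m) → Set
  Geodesic u ws = Walk u ws × Far (length ws) u × (∀ w ws′ → Aug w ws′ → length ws ≤ length ws′)

  geodesic-tail : ∀ {u v ws} → Geodesic u (v ∷ ws) → Geodesic v ws
  geodesic-tail ((u⟶v , walk) , (_ , far) , shortest) =
    walk , far _ u⟶v , λ w ws′ aug → ≤-trans (n≤1+n _) (shortest w ws′ aug)

  geodesic⇒∉dead : ∀ {u ws} → Geodesic u ws → u ∉ dead
  geodesic⇒∉dead {ws = ws} (walk , _ , shortest) u∈D with escape-dead ws u∈D walk
  ... | w , ws′ , aug , shorter = <⇒≱ shorter (shortest w ws′ aug)

  vertices⇒∉dead : ∀ {u} ws {z} → Geodesic u ws → z ∈ Vertices u ws → z ∉ dead
  vertices⇒∉dead {u} [] geo z∈V with x∈⁅y⁆⇒x≡y u z∈V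
  ... | refl = geodesic⇒∉dead {ws = []} geo
  vertices⇒∉dead {u} (v ∷ ws) geo z∈V with x∈p∪q⁻ ⁅ u ⁆ _ z∈V
  ... | inj₂ z∈V′ = vertices⇒∉dead ws (geodesic-tail geo) z∈V′
  ... | inj₁ z∈u with x∈⁅y⁆⇒x≡y u z∈u
  ...   | refl = geodesic⇒∉dead {ws = v ∷ ws} geo

  -- An arc into a part that `I` misses would end in `dead`, which geodesics avoid, or in the new
  -- part, where a shorter augmenting path would start.
  geodesic-mate : ∀ {y x ws} → Geodesic y (x ∷ ws) → y ∈ I → x ∉ I × part x ≡ part y
  geodesic-mate ((( _ , _ , inj₂ (y∉I , _)) , _) , _) y∈I = contradiction y∈I y∉I
  geodesic-mate {y} {x} {ws} geo@(((_ , sx , inj₁ (_ , x∉I , p)) , walk) , _ , shortest) y∈I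
    with mate-or-unhit y∈I x∉I p
  ... | inj₁ px≡py = x∉I , px≡py
  ... | inj₂ unhit with unhit⇒dead-or-new sx unhit
  ...   | inj₁ x∈D  = contradiction x∈D (geodesic⇒∉dead (geodesic-tail geo))
  ...   | inj₂ px≡i = contradiction (shortest x ws (px≡i , walk)) (<⇒≱ ≤-refl)

  vertex-walk : ∀ u ws {z} → z ∈ Vertices u ws → Walk u ws →
                ∃ λ ws′ → Walk z ws′ × length ws′ ≤ length ws
  vertex-walk u [] z∈V walk with x∈⁅y⁆⇒x≡y u z∈V
  ... | refl = [] , walk , z≤n
  vertex-walk u (v ∷ ws) z∈V walk with x∈p∪q⁻ ⁅ u ⁆ _ z∈V
  ... | inj₁ z∈u with x∈⁅y⁆⇒x≡y u z∈u
  ...   | refl = v ∷ ws , walk , ≤-refl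
  vertex-walk u (v ∷ ws) z∈V (_ , walk) | inj₂ z∈V′ with vertex-walk v ws z∈V′ walk
  ...   | ws′ , walk′ , shorter = ws′ , walk′ , m≤n⇒m≤1+n shorter

  far⇒∉vertices : ∀ {z u} ws → Far (suc (length ws)) z → Walk u ws → z ∉ Vertices u ws
  far⇒∉vertices {u = u} ws far walk z∈V with vertex-walk u ws z∈V walk
  ... | ws′ , walk′ , shorter = <⇒≱ (far⇒walk-long _ ws′ far walk′) shorter

  ∣vertices∣≤ : ∀ u ws → ∣ Vertices u ws ∣ ≤ suc (length ws)
  ∣vertices∣≤ u []       = ≤-reflexive (∣⁅x⁆∣≡1 u)
  ∣vertices∣≤ u (v ∷ ws) = ≤-trans (∣A∪B∣≤∣A∣+∣B∣ ⁅ u ⁆ _)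
    (≤-trans (≤-reflexive (cong (_+ _) (∣⁅x⁆∣≡1 u))) (s≤s (∣vertices∣≤ v ws)))

  -- For a suffix of an augmenting path starting at x, the exchanged set I Δ V
  -- minus x is obtained from I by replacing elements within their parts.
  record Exchanged (x : Fin m) (V : Subset m) : Set where
    field
      core         : Subset m
      Δ≡core+x     : I Δ V ≡ core +ₛ x
      x∉core       : x ∉ core
      core+x-indep : Indep M (core +ₛ x)
      core-pindep  : PIndep part core
      hit          : ∀ {z} → z ∈ I → ∃ λ z′ → z′ ∈ core × part z′ ≡ part z
      hit⁻         : ∀ {z} → z ∈ core → ∃ λ z′ → z′ ∈ I × part z′ ≡ part z
      ∣∩∣-≤        : ∀ S → PartClosed part S → ∣ S ∩ I ∣ ≤ ∣ S ∩ core ∣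

  -- Induction from the free end of the path. Once the suffix from `x′` has been exchanged, `y`
  -- gives way to its mate `x′` in `core`, and `x` takes the role of the added element.
  exchanged : ∀ x ws → x ∉ I → Geodesic x ws → Exchanged x (Vertices x ws)
  exchanged x [] x∉I ((sx , _ , iI+x) , _) = record
    { core         = I
    ; Δ≡core+x     = ⊆-antisym Δ⊆ ⊆Δ
    ; x∉core       = x∉I
    ; core+x-indep = iI+x
    ; core-pindep  = pindep
    ; hit          = λ z∈I → _ , z∈I , refl
    ; hit⁻         = λ z∈I → _ , z∈I , refl
    ; ∣∩∣-≤        = λ S closed → ≤-refl
    }
    where
    Δ⊆ : I Δ ⁅ x ⁆ ⊆ I +ₛ x
    Δ⊆ z∈ with ∈-Δ⁻ {A = I} {⁅ x ⁆} z∈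
    ... | inj₁ (z∈I , _) = ∈-+ₛˡ z∈I
    ... | inj₂ (z∈x , _) = x∈p∪q⁺ (inj₂ z∈x)
    ⊆Δ : I +ₛ x ⊆ I Δ ⁅ x ⁆
    ⊆Δ z∈ with ∈-+ₛ⁻ {A = I} z∈
    ... | inj₁ z∈I  = ∈-Δ⁺ {A = I} (inj₁ (z∈I , λ z∈x → x∉I (subst (_∈ I) (x∈⁅y⁆⇒x≡y x z∈x) z∈I)))
    ... | inj₂ refl = ∈-Δ⁺ {A = I} (inj₂ (x∈⁅x⁆ x , x∉I))
  exchanged x (y ∷ ws) x∉I (((_ , _ , inj₁ (x∈I , _)) , _) , _) = contradiction x∈I x∉I
  exchanged x (y ∷ []) x∉I (((_ , _ , inj₂ (_ , y∈I , _)) , (_ , y∉I , _)) , _) = contradiction y∈I y∉I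
  exchanged x (y ∷ x′ ∷ ws) x∉I
    geo@((x⟶y@(sx , _ , inj₂ (_ , y∈I , iI-y+x)) , _ , walk′) , far@(¬free , far-x) , _) = record
    { core         = core
    ; Δ≡core+x     = ⊆-antisym Δ⊆ ⊆Δ
    ; x∉core       = x∉J′ ∘ proj₁ ∘ core⁻
    ; core+x-indep = indep-⊆ M (+ₛ-mono (λ z∈ → ∈-minus⁺ (proj₁ (core⁻ z∈)) (proj₂ (core⁻ z∈)))) J′-y+x-indep
    ; core-pindep  = PIndep-swap E.core-pindep y∈K′ px′≡py
    ; hit          = hit
    ; hit⁻         = hit⁻
    ; ∣∩∣-≤        = λ S closed → ≤-trans (E.∣∩∣-≤ S closed) (∣∩∣-step S closed)
    }
    where
    mate = geodesic-mate (geodesic-tail geo) y∈I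
    x′∉I = proj₁ mate
    px′≡py = proj₂ mate
    module E = Exchanged (exchanged x′ ws x′∉I (geodesic-tail (geodesic-tail geo)))
    K′ = E.core
    V′ = Vertices x′ ws
    core = (K′ - y) +ₛ x′
    far-y : Far (suc (length ws)) y
    far-y = far-x y x⟶y
    x∉V′ : x ∉ V′
    x∉V′ = far⇒∉vertices ws (far-pred _ far) walk′
    y∉V′ : y ∉ V′
    y∉V′ = far⇒∉vertices ws far-y walk′
    x′≢y : x′ ≢ y
    x′≢y refl = x′∉I y∈I
    J′⇒ : ∀ {z} → z ∈ K′ +ₛ x′ → z ∈ I Δ V′
    J′⇒ {z} = subst (z ∈_) (sym E.Δ≡core+x)
    J′⇐ : ∀ {z} → z ∈ I Δ V′ → z ∈ K′ +ₛ x′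
    J′⇐ {z} = subst (z ∈_) E.Δ≡core+x
    y∈K′ : y ∈ K′
    y∈K′ with ∈-+ₛ⁻ {A = K′} (J′⇐ (∈-Δ⁺ {A = I} (inj₁ (y∈I , y∉V′))))
    ... | inj₁ y∈K′ = y∈K′
    ... | inj₂ y≡x′ = contradiction (sym y≡x′) x′≢y
    core⁻ : ∀ {z} → z ∈ core → z ∈ K′ +ₛ x′ × z ≢ y
    core⁻ z∈ with ∈-+ₛ⁻ {A = K′ - y} z∈
    ... | inj₁ z∈K′-y = ∈-+ₛˡ (proj₁ (∈-minus⁻ z∈K′-y)) , proj₂ (∈-minus⁻ z∈K′-y)
    ... | inj₂ refl   = ∈-+ₛʳ {A = K′} , x′≢y
    core⁺ : ∀ {z} → z ∈ K′ +ₛ x′ → z ≢ y → z ∈ core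
    core⁺ z∈ z≢y with ∈-+ₛ⁻ {A = K′} z∈
    ... | inj₁ z∈K′ = ∈-+ₛˡ (∈-minus⁺ z∈K′ z≢y)
    ... | inj₂ refl = ∈-+ₛʳ {A = K′ - y}
    x∉J′ : x ∉ K′ +ₛ x′
    x∉J′ x∈ with ∈-Δ⁻ {A = I} {V′} (J′⇒ x∈)
    ... | inj₁ (x∈I , _)  = x∉I x∈I
    ... | inj₂ (x∈V′ , _) = x∉V′ x∈V′
    -- The no-shortcut argument: an arc from `x` to a vertex of `V′` would shorten the path, so all
    -- out-neighbours of `x` lie in `I ─ V′`. The exchange of `y` for `x` is checked there and
    -- carried over to `K′ +ₛ x′`.
    J′-y+x-indep : Indep M (((K′ +ₛ x′) - y) +ₛ x)
    J′-y+x-indep = swap-indep {A = I ─ V′} E.core+x-indep x∉J′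
      (λ z∈ → J′⇐ (∈-Δ⁺ {A = I} (inj₁ (∈-─⁻ I V′ z∈))))
      (x∈p∧x∉q⇒x∈p─q y∈I y∉V′)
      (blocked⇒dependent sx x∉I ¬free (p─q⊆p I V′)
        λ z∈I x⟶z → x∈p∧x∉q⇒x∈p─q z∈I (far⇒∉vertices ws (far-x _ x⟶z) walk′))
      (indep-⊆ M (+ₛ-mono λ z∈ → ∈-minus⁺ (p─q⊆p I V′ (proj₁ (∈-minus⁻ z∈))) (proj₂ (∈-minus⁻ z∈))) iI-y+x)
    Δ⊆ : I Δ Vertices x (y ∷ x′ ∷ ws) ⊆ core +ₛ x
    Δ⊆ {z} z∈ with ∈-Δ⁻ {A = I} z∈
    ... | inj₁ (z∈I , z∉V) = ∈-+ₛˡ (core⁺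
      (J′⇐ (∈-Δ⁺ {A = I} (inj₁ (z∈I , λ z∈V′ → z∉V (q⊆p∪q ⁅ x ⁆ _ (q⊆p∪q ⁅ y ⁆ _ z∈V′))))))
      λ { refl → z∉V (q⊆p∪q ⁅ x ⁆ _ (p⊆p∪q _ (x∈⁅x⁆ y))) })
    ... | inj₂ (z∈V , z∉I) with x∈p∪q⁻ ⁅ x ⁆ _ z∈V
    ...   | inj₁ z∈x = x∈p∪q⁺ (inj₂ z∈x)
    ...   | inj₂ z∈yV′ with x∈p∪q⁻ ⁅ y ⁆ _ z∈yV′
    ...     | inj₁ z∈y  = contradiction (subst (_∈ I) (sym (x∈⁅y⁆⇒x≡y y z∈y)) y∈I) z∉I
    ...     | inj₂ z∈V′ = ∈-+ₛˡ (core⁺ (J′⇐ (∈-Δ⁺ {A = I} (inj₂ (z∈V′ , z∉I)))) λ { refl → z∉I y∈I })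
    ⊆Δ : core +ₛ x ⊆ I Δ Vertices x (y ∷ x′ ∷ ws)
    ⊆Δ {z} z∈ with ∈-+ₛ⁻ {A = core} z∈
    ... | inj₂ refl = ∈-Δ⁺ {A = I} (inj₂ (p⊆p∪q _ (x∈⁅x⁆ x) , x∉I))
    ... | inj₁ z∈core with core⁻ z∈core
    ...   | z∈J′ , z≢y with ∈-Δ⁻ {A = I} {V′} (J′⇒ z∈J′)
    ...     | inj₂ (z∈V′ , z∉I) = ∈-Δ⁺ {A = I} (inj₂ (q⊆p∪q ⁅ x ⁆ _ (q⊆p∪q ⁅ y ⁆ _ z∈V′) , z∉I))
    ...     | inj₁ (z∈I , z∉V′) = ∈-Δ⁺ {A = I} (inj₁ (z∈I , z∉V))
      where
      z∉V : z ∉ Vertices x (y ∷ x′ ∷ ws)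
      z∉V z∈V with x∈p∪q⁻ ⁅ x ⁆ _ z∈V
      ... | inj₁ z∈x = x∉I (subst (_∈ I) (x∈⁅y⁆⇒x≡y x z∈x) z∈I)
      ... | inj₂ z∈yV′ with x∈p∪q⁻ ⁅ y ⁆ _ z∈yV′
      ...   | inj₁ z∈y  = z≢y (x∈⁅y⁆⇒x≡y y z∈y)
      ...   | inj₂ z∈V′ = z∉V′ z∈V′
    hit : ∀ {z} → z ∈ I → ∃ λ z′ → z′ ∈ core × part z′ ≡ part z
    hit z∈I with E.hit z∈I
    ... | z′ , z′∈K′ , eq with z′ ≟F y
    ...   | yes refl = x′ , ∈-+ₛʳ {A = K′ - y} , trans px′≡py eq
    ...   | no z′≢y  = z′ , ∈-+ₛˡ (∈-minus⁺ z′∈K′ z′≢y) , eq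
    hit⁻ : ∀ {z} → z ∈ core → ∃ λ z′ → z′ ∈ I × part z′ ≡ part z
    hit⁻ z∈ with ∈-+ₛ⁻ {A = K′ - y} z∈
    ... | inj₁ z∈K′-y = E.hit⁻ (proj₁ (∈-minus⁻ z∈K′-y))
    ... | inj₂ refl   = y , y∈I , sym px′≡py
    -- `y` and `x′` share a part, so a union of parts that loses `y` gains `x′`.
    ∣∩∣-step : ∀ S → PartClosed part S → ∣ S ∩ K′ ∣ ≤ ∣ S ∩ core ∣
    ∣∩∣-step S closed with y ∈? S
    ... | yes y∈S = swap-∣∣-≤ {A = S ∩ K′} {y = y}
      (λ z∈ → case ∈-minus⁻ z∈ of λ { (z∈SK′ , z≢y) → case x∈p∩q⁻ S K′ z∈SK′ of λ
        { (z∈S , z∈K′) → x∈p∩q⁺ (z∈S , ∈-+ₛˡ (∈-minus⁺ z∈K′ z≢y)) } })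
      (x∈p∩q⁺ (closed y x′ y∈S (sym px′≡py) , ∈-+ₛʳ {A = K′ - y}))
      (λ x′∈ → E.x∉core (proj₂ (x∈p∩q⁻ S K′ x′∈)))
    ... | no y∉S = p⊆q⇒∣p∣≤∣q∣ {p = S ∩ K′} {q = S ∩ core} λ z∈ → case x∈p∩q⁻ S K′ z∈ of λ
      { (z∈S , z∈K′) → x∈p∩q⁺ (z∈S , ∈-+ₛˡ (∈-minus⁺ z∈K′ λ { refl → y∉S z∈S })) }

  -- Invariance of soundness

  -- The path avoids `dead`, so `I` does not change there and the same `dead` remains valid. Parts
  -- that were hit stay hit, and `v` hits the new one.
  augment-sound : ∀ {v vs} → part v ≡ i → Geodesic v vs →
                  Sound M part (suc (toℕ i)) (I Δ Vertices v vs)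
  augment-sound {v} {vs} pv≡i geo = record
    { indep      = subst (Indep M) (sym E.Δ≡core+x) E.core+x-indep
    ; pindep     = subst (PIndep part) (sym E.Δ≡core+x)
        (PIndep-add E.core-pindep λ z z∈core pz≡pv → <-irrefl (cong toℕ (trans pz≡pv pv≡i)) (core-early z∈core))
    ; early      = early′
    ; dead       = dead
    ; dead-unhit = dead-unhit′
    ; dead-span  = λ x∈D x∉I′ → dead-span x∈D (λ x∈I → x∉I′ (dead-stays x∈D x∈I)) ∘ indep-⊆ M (+ₛ-mono λ z∈ →
        case x∈p∩q⁻ I dead z∈ of λ { (z∈I , z∈D) → x∈p∩q⁺ (dead-stays z∈D z∈I , z∈D) })
    ; dead-mate  = dead-mate′
    }
    where
    V = Vertices v vs
    module E = Exchanged (exchanged v vs (new⇒∉I pv≡i) geo)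
    core-early : ∀ {z} → z ∈ E.core → toℕ (part z) < toℕ i
    core-early z∈ with E.hit⁻ z∈
    ... | z′ , z′∈I , eq = subst (λ j → toℕ j < toℕ i) eq (early z′∈I)
    early′ : ∀ {x} → x ∈ I Δ V → toℕ (part x) < suc (toℕ i)
    early′ {x} x∈ with ∈-+ₛ⁻ {A = E.core} (subst (x ∈_) E.Δ≡core+x x∈)
    ... | inj₁ x∈core = m≤n⇒m≤1+n (core-early x∈core)
    ... | inj₂ refl   = s≤s (≤-reflexive (cong toℕ pv≡i))
    dead-stays : ∀ {x} → x ∈ dead → x ∈ I → x ∈ I Δ V
    dead-stays x∈D x∈I = ∈-Δ⁺ {A = I} (inj₁ (x∈I , λ x∈V → vertices⇒∉dead vs geo x∈V x∈D))
    core⊆ : E.core ⊆ I Δ V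
    core⊆ {z} z∈ = subst (z ∈_) (sym E.Δ≡core+x) (∈-+ₛˡ z∈)
    dead-unhit′ : ∀ {x} → toℕ (part x) < suc (toℕ i) → (∀ z → z ∈ I Δ V → part z ≢ part x) → x ∈ dead
    dead-unhit′ (s≤s px≤i) unhit with unhit⇒dead-or-new px≤i (λ z z∈I pz≡px → case E.hit z∈I of λ
      { (z′ , z′∈core , eq) → unhit z′ (core⊆ z′∈core) (trans eq pz≡px) })
    ... | inj₁ x∈D  = x∈D
    ... | inj₂ px≡i = contradiction (trans pv≡i (sym px≡i))
      (unhit v (subst (v ∈_) (sym E.Δ≡core+x) (∈-+ₛʳ {A = E.core})))
    dead-mate′ : ∀ {x y} → y ∈ dead → y ∈ I Δ V → x ∉ I Δ V → part x ≡ part y → x ∈ dead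
    dead-mate′ {x} {y} y∈D y∈I′ x∉I′ px≡py with ∈-Δ⁻ {A = I} {V} y∈I′
    ... | inj₂ (y∈V , _) = contradiction y∈D (vertices⇒∉dead vs geo y∈V)
    ... | inj₁ (y∈I , _) with x ∈? I
    ...   | yes x∈I = subst (_∈ dead) (sym (pindep x y x∈I y∈I px≡py)) y∈D
    ...   | no x∉I  = dead-mate y∈D y∈I x∉I px≡py

  -- The source of monotonicity of the potential: `core` only trades elements within parts, and `v`
  -- comes on top.
  augment-∣∩∣ : ∀ {v vs} → part v ≡ i → Geodesic v vs → ∀ {S} → PartClosed part S →
                ∣ S ∩ I ∣ ≤ ∣ S ∩ (I Δ Vertices v vs) ∣ ×
                (v ∈ S → ∣ S ∩ I ∣ < ∣ S ∩ (I Δ Vertices v vs) ∣)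
  augment-∣∩∣ {v} {vs} pv≡i geo {S} closed =
    subst (λ I′ → ∣ S ∩ I ∣ ≤ ∣ S ∩ I′ ∣ × (v ∈ S → ∣ S ∩ I ∣ < ∣ S ∩ I′ ∣)) (sym E.Δ≡core+x)
      ( ≤-trans (E.∣∩∣-≤ S closed) (p⊆q⇒∣p∣≤∣q∣ {p = S ∩ E.core} {q = S ∩ (E.core +ₛ v)} grow)
      , λ v∈S → ≤-trans (s≤s (E.∣∩∣-≤ S closed))
          (A⊆B∧x∉A⇒∣A∣<∣B∣ {A = S ∩ E.core} {B = S ∩ (E.core +ₛ v)} grow
            (x∈p∩q⁺ (v∈S , ∈-+ₛʳ {A = E.core})) (λ v∈ → E.x∉core (proj₂ (x∈p∩q⁻ S E.core v∈)))) )
    where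
    module E = Exchanged (exchanged v vs (new⇒∉I pv≡i) geo)
    grow : S ∩ E.core ⊆ S ∩ (E.core +ₛ v)
    grow z∈ with x∈p∩q⁻ S E.core z∈
    ... | z∈S , z∈core = x∈p∩q⁺ (z∈S , ∈-+ₛˡ z∈core)

  -- The new `dead` is the set of revealed elements from which no free element can be reached. It is
  -- closed under arcs. An unhit old part lies in the old `dead`, so by `escape-dead` a walk from it
  -- would yield an augmenting path.
  blocked-sound : (∀ u → Dec (∃ (Walk u))) → ¬ (∃ λ v → ∃ (Aug v)) → Sound M part (suc (toℕ i)) I
  blocked-sound walk? ¬aug = record
    { indep      = indep
    ; pindep     = pindep
    ; early      = m≤n⇒m≤1+n ∘ early
    ; dead       = stuck
    ; dead-unhit = dead-unhit′
    ; dead-span  = λ x∈ x∉I → case stuck⁻ x∈ of λ { (sx , ¬walk) →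
        blocked⇒dependent sx x∉I (λ free → ¬walk ([] , free)) (p∩q⊆p I stuck)
          λ {y} y∈I x⟶y → x∈p∩q⁺ (y∈I , stuck⁺ (seen-I y∈I , λ { (ws , walk) → ¬walk (y ∷ ws , x⟶y , walk) })) }
    ; dead-mate  = λ {x} y∈ y∈I x∉I px≡py → case mate-arc y∈I x∉I px≡py of λ { y⟶x@(_ , sx , _) →
        stuck⁺ (sx , λ { (ws , walk) → proj₂ (stuck⁻ y∈) (x ∷ ws , y⟶x , walk) }) }
    }
    where
    stuck? : Decidable (λ x → Seen x × ¬ ∃ (Walk x))
    stuck? x = seen? x ×-dec ¬? (walk? x)
    stuck = comprehension stuck?
    stuck⁺ : ∀ {x} → Seen x × ¬ ∃ (Walk x) → x ∈ stuck
    stuck⁺ = ∈-comprehension⁺ stuck?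
    stuck⁻ : ∀ {x} → x ∈ stuck → Seen x × ¬ ∃ (Walk x)
    stuck⁻ = ∈-comprehension⁻ stuck?
    dead-unhit′ : ∀ {x} → toℕ (part x) < suc (toℕ i) → (∀ z → z ∈ I → part z ≢ part x) → x ∈ stuck
    dead-unhit′ {x} (s≤s px≤i) unhit with unhit⇒dead-or-new px≤i unhit
    ... | inj₂ px≡i = stuck⁺ (px≤i , λ { (ws , walk) → ¬aug (x , ws , px≡i , walk) })
    ... | inj₁ x∈D  = stuck⁺ (px≤i , λ { (ws , walk) → case escape-dead ws x∈D walk of λ
      { (w , ws′ , aug , _) → ¬aug (w , ws′ , aug) } })

  -- Expansion

  -- Elements far from the free elements replace a breadth-first search from the new part:
  -- what can be reached from far-set (2 + e) in two steps lies in far-set e.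
  far-set : ℕ → Subset m
  far-set e = comprehension (λ y → (y ∈? I) ×-dec far? e y)

  far-set⁺ : ∀ {e y} → y ∈ I → Far e y → y ∈ far-set e
  far-set⁺ y∈I far = ∈-comprehension⁺ (λ y → (y ∈? I) ×-dec far? _ y) (y∈I , far)

  far-set⁻ : ∀ e {y} → y ∈ far-set e → y ∈ I × Far e y
  far-set⁻ e = ∈-comprehension⁻ (λ y → (y ∈? I) ×-dec far? e y)

  far⇒dependent : ∀ {e x A} → Seen x → x ∉ I → Far (suc e) x → A ⊆ I →
                  (∀ {y} → y ∈ I → Far e y → y ∈ A) → ¬ Indep M (A +ₛ x)
  far⇒dependent sx x∉I (¬free , far) A⊆I closed =
    blocked⇒dependent sx x∉I ¬free A⊆I λ y∈I x⟶y → closed y∈I (far _ x⟶y)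

  far⇒spanned : ∀ {e x} → Seen x → x ∉ I → Far (suc e) x → Spanned (far-set e) x
  far⇒spanned {e} sx x∉I far = inj₂ (far-set e , (λ z → z) , indep-⊆ M far-set⊆I indep ,
    far⇒dependent sx x∉I far far-set⊆I far-set⁺)
    where
    far-set⊆I : far-set e ⊆ I
    far-set⊆I = proj₁ ∘ far-set⁻ e

  -- Maximality of the excess (p + 1) ∣ S ∩ I ∣ − p rank S over unions of parts,
  -- with the negative terms moved across.
  Maximal : ℕ → Subset m → Set
  Maximal p S = PartClosed part S × (∀ T → PartClosed part T →
    suc p * ∣ T ∩ I ∣ + p * rank S ≤ suc p * ∣ S ∩ I ∣ + p * rank T)

  maximal : ∀ p → ∃ (Maximal p)
  maximal p with argmax closed? score (suc p * m + p * m) score≤ (⊥ , λ x y x∈⊥ → contradiction x∈⊥ ∉⊥)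
    where
    closed? : Decidable (PartClosed part)
    closed? S = all? λ x → all? λ y → (x ∈? S) →-dec ((part x ≟F part y) →-dec (y ∈? S))
    -- Adding `p * m` avoids negative scores; the truncated subtraction is exact because
    -- `rank S ≤ m`.
    score : Subset m → ℕ
    score S = suc p * ∣ S ∩ I ∣ + p * (m ∸ rank S)
    score≤ : ∀ S → score S ≤ suc p * m + p * m
    score≤ S = +-mono-≤ (*-monoʳ-≤ (suc p) (∣p∣≤n (S ∩ I))) (*-monoʳ-≤ p (m∸n≤m m (rank S)))
  ... | S , closed , best = S , closed , λ T T-closed → +-cancelʳ-≤ (p * (m ∸ rank S) + p * (m ∸ rank T)) _ _ (begin
    (a T + p * rank S) + (p * (m ∸ rank S) + p * (m ∸ rank T))  ≡⟨ regroup (a T) p (rank S) (m ∸ rank S) (m ∸ rank T) ⟩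
    (a T + p * (m ∸ rank T)) + p * (rank S + (m ∸ rank S))      ≤⟨ +-mono-≤ (best T T-closed) (*-monoʳ-≤ p (≤-reflexive (trans (whole S) (sym (whole T))))) ⟩
    (a S + p * (m ∸ rank S)) + p * (rank T + (m ∸ rank T))      ≡⟨ regroup′ (a S) p (rank T) (m ∸ rank S) (m ∸ rank T) ⟩
    (a S + p * rank T) + (p * (m ∸ rank S) + p * (m ∸ rank T))  ∎)
    where
    open ≤-Reasoning
    a : Subset m → ℕ
    a T = suc p * ∣ T ∩ I ∣
    whole : ∀ T → rank T + (m ∸ rank T) ≡ m
    whole T = m+[n∸m]≡n (rank≤m T)
    regroup : ∀ a p r u v → (a + p * r) + (p * u + p * v) ≡ (a + p * v) + p * (r + u)
    regroup = solve-∀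
    regroup′ : ∀ a p r u v → (a + p * u) + p * (r + v) ≡ (a + p * r) + (p * u + p * v)
    regroup′ = solve-∀

  module _ {p : ℕ} {S : Subset m} (S-maximal : Maximal p S) where

    -- Maximality is tested against `T`, which is `S` with all parts that meet `Z`. This gains
    -- `∣ Z ─ S ∣` elements of `I`, while the mates of `Z` are spanned by `far-set e`, so the rank
    -- grows by at most `∣ far-set e ─ S ∣`.
    expansion : ∀ e → suc p * ∣ far-set (2 + e) ─ S ∣ ≤ p * ∣ far-set e ─ S ∣
    expansion e = +-cancelˡ-≤ (suc p * ∣ S ∩ I ∣ + p * rank S) _ _ (begin
      (suc p * ∣ S ∩ I ∣ + p * rank S) + suc p * ∣ Z ─ S ∣   ≡⟨ regroup (suc p) (∣ S ∩ I ∣) (p * rank S) (∣ Z ─ S ∣) ⟩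
      suc p * (∣ S ∩ I ∣ + ∣ Z ─ S ∣) + p * rank S           ≤⟨ +-monoˡ-≤ _ (*-monoʳ-≤ (suc p) T∩I≥) ⟩
      suc p * ∣ T ∩ I ∣ + p * rank S                         ≤⟨ proj₂ S-maximal T T-closed ⟩
      suc p * ∣ S ∩ I ∣ + p * rank T                         ≤⟨ +-monoʳ-≤ _ (*-monoʳ-≤ p rank-T≤) ⟩
      suc p * ∣ S ∩ I ∣ + p * (rank S + ∣ far-set e ─ S ∣)   ≡⟨ regroup′ (suc p * ∣ S ∩ I ∣) p (rank S) (∣ far-set e ─ S ∣) ⟩
      (suc p * ∣ S ∩ I ∣ + p * rank S) + p * ∣ far-set e ─ S ∣ ∎)
      where
      open ≤-Reasoning
      regroup : ∀ q a r z → (q * a + r) + q * z ≡ q * (a + z) + r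
      regroup = solve-∀
      regroup′ : ∀ a p r z → a + p * (r + z) ≡ (a + p * r) + p * z
      regroup′ = solve-∀
      Z = far-set (2 + e)
      mate? : Decidable (λ x → ∃ λ y → y ∈ Z × part x ≡ part y)
      mate? x = any? λ y → (y ∈? Z) ×-dec (part x ≟F part y)
      T = S ∪ comprehension mate?
      Z⊆T : Z ⊆ T
      Z⊆T {z} z∈Z = q⊆p∪q S _ (∈-comprehension⁺ mate? (z , z∈Z , refl))
      T-closed : PartClosed part T
      T-closed x y x∈T px≡py with x∈p∪q⁻ S _ x∈T
      ... | inj₁ x∈S = p⊆p∪q _ (proj₁ S-maximal x y x∈S px≡py)
      ... | inj₂ x∈ with ∈-comprehension⁻ mate? x∈
      ...   | z , z∈Z , px≡pz = q⊆p∪q S _ (∈-comprehension⁺ mate? (z , z∈Z , trans (sym px≡py) px≡pz))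
      T∩I≥ : ∣ S ∩ I ∣ + ∣ Z ─ S ∣ ≤ ∣ T ∩ I ∣
      T∩I≥ = ≤-trans
        (+-mono-≤
          (p⊆q⇒∣p∣≤∣q∣ {p = S ∩ I} {q = (T ∩ I) ∩ S} λ z∈ → case x∈p∩q⁻ S I z∈ of λ
            { (z∈S , z∈I) → x∈p∩q⁺ (x∈p∩q⁺ (p⊆p∪q _ z∈S , z∈I) , z∈S) })
          (p⊆q⇒∣p∣≤∣q∣ {p = Z ─ S} {q = (T ∩ I) ─ S} λ z∈ → case ∈-─⁻ Z S z∈ of λ
            { (z∈Z , z∉S) → x∈p∧x∉q⇒x∈p─q (x∈p∩q⁺ (Z⊆T z∈Z , proj₁ (far-set⁻ (2 + e) z∈Z))) z∉S }))
        (≤-reflexive (sym (∣A∣≡∣A∩B∣+∣A─B∣ (T ∩ I) S)))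
      rank-T≤ : rank T ≤ rank S + ∣ far-set e ─ S ∣
      T-spanned : ∀ {x} → x ∈ T → Spanned (S ∪ far-set e) x
      rank-T≤ = ≤-trans (spanned⇒rank≤ T-spanned) (rank-∪-≤ S (far-set e))
      T-spanned {x} x∈T with x∈p∪q⁻ S _ x∈T
      ... | inj₁ x∈S = inj₁ (p⊆p∪q _ x∈S)
      ... | inj₂ x∈ with ∈-comprehension⁻ mate? x∈
      ...   | y , y∈Z , px≡py with far-set⁻ (2 + e) y∈Z
      ...     | y∈I , far-y with x ∈? I
      ...       | yes x∈I = inj₁ (q⊆p∪q S _ (far-set⁺ x∈I
        (far-pred e (far-pred (suc e) (subst (Far (2 + e)) (sym (pindep x y x∈I y∈I px≡py)) far-y)))))
      ...       | no x∉I with mate-arc y∈I x∉I px≡py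
      ...         | y⟶x@(_ , sx , _) with far⇒spanned {e} sx x∉I (proj₂ far-y x y⟶x)
      ...           | inj₁ x∈Z′ = inj₁ (q⊆p∪q S _ x∈Z′)
      ...           | inj₂ (A , A⊆Z′ , iA , dA+x) = inj₂ (A , q⊆p∪q S _ ∘ A⊆Z′ , iA , dA+x)

    expansion-^ : ∀ d → suc p ^ d * ∣ far-set (d * 2) ─ S ∣ ≤ p ^ d * ∣ far-set 0 ─ S ∣
    expansion-^ zero    = ≤-refl
    expansion-^ (suc d) = begin
      suc p * suc p ^ d * ∣ far-set (2 + d * 2) ─ S ∣   ≡⟨ regroup (suc p) (suc p ^ d) _ ⟩
      suc p ^ d * (suc p * ∣ far-set (2 + d * 2) ─ S ∣) ≤⟨ *-monoʳ-≤ (suc p ^ d) (expansion (d * 2)) ⟩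
      suc p ^ d * (p * ∣ far-set (d * 2) ─ S ∣)         ≡⟨ regroup′ (suc p ^ d) p _ ⟩
      p * (suc p ^ d * ∣ far-set (d * 2) ─ S ∣)         ≤⟨ *-monoʳ-≤ p (expansion-^ d) ⟩
      p * (p ^ d * ∣ far-set 0 ─ S ∣)                   ≡⟨ *-assoc p (p ^ d) _ ⟨
      p * p ^ d * ∣ far-set 0 ─ S ∣                     ∎
      where
      open ≤-Reasoning
      regroup : ∀ a b c → a * b * c ≡ b * (a * c)
      regroup = solve-∀
      regroup′ : ∀ a b c → a * (b * c) ≡ b * (a * c)
      regroup′ = solve-∀

    -- A single element of `far-set (d * 2)` outside `S` would, after `d` expansions, force more
    -- than `n` elements into `far-set 0 ─ S`, a subset of `I`. Hence all out-neighbours of `x` lie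
    -- in `I ∩ S`.
    far⇒spanned-by-maximal : ∀ {n x} d → ∣ I ∣ ≤ n → p ^ d * n < suc p ^ d →
                             Seen x → x ∉ I → Far (suc (d * 2)) x → Spanned S x
    far⇒spanned-by-maximal {n} {x} d ∣I∣≤n growth sx x∉I far =
      inj₂ (I ∩ S , p∩q⊆q I S , indep-⊆ M (p∩q⊆p I S) indep ,
        far⇒dependent {d * 2} sx x∉I far (p∩q⊆p I S) closed)
      where
      closed : ∀ {y} → y ∈ I → Far (d * 2) y → y ∈ I ∩ S
      closed {y} y∈I far-y with y ∈? S
      ... | yes y∈S = x∈p∩q⁺ (y∈I , y∈S)
      ... | no y∉S  = contradiction growth (≤⇒≯ (begin
        suc p ^ d                                   ≡⟨ *-identityʳ _ ⟨
        suc p ^ d * 1                               ≤⟨ *-monoʳ-≤ (suc p ^ d) nonempty ⟩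
        suc p ^ d * ∣ far-set (d * 2) ─ S ∣         ≤⟨ expansion-^ d ⟩
        p ^ d * ∣ far-set 0 ─ S ∣                   ≤⟨ *-monoʳ-≤ (p ^ d) bounded ⟩
        p ^ d * n                                   ∎))
        where
        open ≤-Reasoning
        nonempty : 1 ≤ ∣ far-set (d * 2) ─ S ∣
        nonempty = ≤-trans (s≤s z≤n)
          (A⊆B∧x∉A⇒∣A∣<∣B∣ {A = ⊥} ⊥⊆ (x∈p∧x∉q⇒x∈p─q (far-set⁺ {d * 2} y∈I far-y) y∉S) ∉⊥)
        bounded : ∣ far-set 0 ─ S ∣ ≤ n
        bounded = ≤-trans (∣p─q∣≤∣p∣ (far-set 0) S)
          (≤-trans (p⊆q⇒∣p∣≤∣q∣ {p = far-set 0} (proj₁ ∘ far-set⁻ 0)) ∣I∣≤n)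

-- Counting

-- The left side is the first two terms of the binomial expansion of the right.
bernoulli : ∀ p n → p ^ suc n + suc n * p ^ n ≤ suc p ^ suc n
bernoulli p zero    = ≤-reflexive (base p)
  where
  base : ∀ p → p * 1 + 1 ≡ suc p * 1
  base = solve-∀
bernoulli p (suc n) = begin
  p * (p * p ^ n) + (2 + n) * (p * p ^ n)                   ≤⟨ m≤m+n _ (suc n * p ^ n) ⟩
  p * (p * p ^ n) + (2 + n) * (p * p ^ n) + suc n * p ^ n   ≡⟨ regroup p n (p ^ n) ⟩
  suc p * (p * p ^ n + suc n * p ^ n)                       ≤⟨ *-monoʳ-≤ (suc p) (bernoulli p n) ⟩
  suc p * suc p ^ suc n                                     ∎
  where
  open ≤-Reasoning
  regroup : ∀ p n x → p * (p * x) + (2 + n) * (p * x) + suc n * x ≡ suc p * (p * x + suc n * x)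
  regroup = solve-∀

2*p^[1+p]≤[1+p]^[1+p] : ∀ p → 2 * p ^ suc p ≤ suc p ^ suc p
2*p^[1+p]≤[1+p]^[1+p] p = begin
  2 * (p * p ^ p)              ≡⟨ cong (p * p ^ p +_) (+-identityʳ _) ⟩
  p * p ^ p + p * p ^ p        ≤⟨ +-monoʳ-≤ (p * p ^ p) (m≤n+m (p * p ^ p) (p ^ p)) ⟩
  p ^ suc p + suc p * p ^ p    ≤⟨ bernoulli p p ⟩
  suc p ^ suc p                ∎
  where open ≤-Reasoning

2*a≤b⇒2^L*a^L≤b^L : ∀ {a b} L → 2 * a ≤ b → 2 ^ L * a ^ L ≤ b ^ L
2*a≤b⇒2^L*a^L≤b^L zero    2a≤b = ≤-refl
2*a≤b⇒2^L*a^L≤b^L {a} {b} (suc L) 2a≤b = begin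
  2 * 2 ^ L * (a * a ^ L)     ≡⟨ regroup (2 ^ L) a (a ^ L) ⟩
  2 * a * (2 ^ L * a ^ L)     ≤⟨ *-mono-≤ 2a≤b (2*a≤b⇒2^L*a^L≤b^L L 2a≤b) ⟩
  b * b ^ L                   ∎
  where
  open ≤-Reasoning
  regroup : ∀ x a y → 2 * x * (a * y) ≡ 2 * a * (x * y)
  regroup = solve-∀

-- Every `suc p` factors of `(p + 1) / p` give at least a doubling, and `L` doublings exceed `n`.
-- For `p = 0`, `1 ≤ L` makes the exponent positive, so the left side vanishes.
^-growth : ∀ {n} p L → 1 ≤ L → n < 2 ^ L → p ^ (suc p * L) * n < suc p ^ (suc p * L)
^-growth zero    (suc L) _ _ = m^n>0 1 (1 * suc L)
^-growth {n} p@(suc _) L _ n<2^L = begin-strict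
  p ^ (suc p * L) * n          ≡⟨ cong (_* n) (^-*-assoc p (suc p) L) ⟨
  (p ^ suc p) ^ L * n          <⟨ *-monoʳ-< ((p ^ suc p) ^ L) {{m^n≢0 (p ^ suc p) L {{m^n≢0 p (suc p)}}}} n<2^L ⟩
  (p ^ suc p) ^ L * 2 ^ L      ≡⟨ *-comm ((p ^ suc p) ^ L) (2 ^ L) ⟩
  2 ^ L * (p ^ suc p) ^ L      ≤⟨ 2*a≤b⇒2^L*a^L≤b^L L (2*p^[1+p]≤[1+p]^[1+p] p) ⟩
  (suc p ^ suc p) ^ L          ≡⟨ ^-*-assoc (suc p) (suc p) L ⟩
  suc p ^ (suc p * L)          ∎
  where open ≤-Reasoning

-- Path lengths against dyadic thresholds

indicator : ∀ {P : Set} → Dec P → ℕ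
indicator (yes _) = 1
indicator (no _)  = 0

exceeds : ℕ → ℕ → ℕ
exceeds b ℓ = indicator (b <? ℓ)

#longer : ℕ → List ℕ → ℕ
#longer b ls = sum (map (exceeds b) ls)

exceeds-yes : ∀ {b ℓ} → b < ℓ → exceeds b ℓ ≡ 1
exceeds-yes {b} {ℓ} b<ℓ with b <? ℓ
... | yes _  = refl
... | no b≮ℓ = contradiction b<ℓ b≮ℓ

exceeds-no : ∀ {b ℓ} → ¬ b < ℓ → exceeds b ℓ ≡ 0
exceeds-no {b} {ℓ} b≮ℓ with b <? ℓ
... | yes b<ℓ = contradiction b<ℓ b≮ℓ
... | no _    = refl

sum-map-+-* : ∀ {A : Set} (f g : A → ℕ) c xs →
              sum (map (λ x → f x + c * g x) xs) ≡ sum (map f xs) + c * sum (map g xs)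
sum-map-+-* f g c []       = sym (*-zeroʳ c)
sum-map-+-* f g c (x ∷ xs) = trans (cong (f x + c * g x +_) (sum-map-+-* f g c xs)) (regroup (f x) (g x) c _ _)
  where
  regroup : ∀ a b c s t → a + c * b + (s + c * t) ≡ a + s + c * (b + t)
  regroup = solve-∀

module Dyadic (L : ℕ) where

  -- The factor `2` counts the two arcs of a double step.
  threshold : ℕ → ℕ
  threshold q = q * L * 2

  -- A dyadic substitute for `ℓ / (2 L)`: the scales `2 ^ b` with `b < a` whose threshold is
  -- exceeded by `ℓ`, summed up.
  levels : ℕ → ℕ → ℕ
  levels zero    ℓ = 0
  levels (suc a) ℓ = levels a ℓ + 2 ^ a * exceeds (threshold (2 ^ a)) ℓ

  -- Doubling the threshold raises ℓ ⊓ threshold by at most the old threshold, and only if ℓ exceeds it.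
  ⊓-threshold≤levels : ∀ a ℓ → ℓ ⊓ threshold (2 ^ a) ≤ L * 2 * suc (levels a ℓ)
  ⊓-threshold≤levels zero ℓ = ≤-trans (m⊓n≤n ℓ _) (≤-reflexive (base L))
    where
    base : ∀ L → 1 * L * 2 ≡ L * 2 * 1
    base = solve-∀
  ⊓-threshold≤levels (suc a) ℓ with threshold (2 ^ a) <? ℓ
  ... | no b≮ℓ = begin
    ℓ ⊓ threshold (2 ^ suc a)                  ≤⟨ m⊓n≤m ℓ _ ⟩
    ℓ                                          ≡⟨ m≤n⇒m⊓n≡m (≮⇒≥ b≮ℓ) ⟨
    ℓ ⊓ threshold (2 ^ a)                      ≤⟨ ⊓-threshold≤levels a ℓ ⟩
    L * 2 * suc (levels a ℓ)                   ≤⟨ *-monoʳ-≤ (L * 2) (s≤s (m≤m+n _ _)) ⟩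
    L * 2 * suc (levels a ℓ + 2 ^ a * 0)       ∎
    where open ≤-Reasoning
  ... | yes b<ℓ = begin
    ℓ ⊓ threshold (2 ^ suc a)                  ≤⟨ m⊓n≤n ℓ _ ⟩
    threshold (2 ^ suc a)                      ≡⟨ split (2 ^ a) L ⟩
    threshold (2 ^ a) + threshold (2 ^ a)      ≡⟨ cong (_+ threshold (2 ^ a)) (m≥n⇒m⊓n≡n (<⇒≤ b<ℓ)) ⟨
    ℓ ⊓ threshold (2 ^ a) + threshold (2 ^ a)  ≤⟨ +-monoˡ-≤ (threshold (2 ^ a)) (⊓-threshold≤levels a ℓ) ⟩
    L * 2 * suc (levels a ℓ) + threshold (2 ^ a) ≡⟨ regroup (2 ^ a) L (levels a ℓ) ⟩
    L * 2 * suc (levels a ℓ + 2 ^ a * 1)       ∎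
    where
    open ≤-Reasoning
    split : ∀ x L → 2 * x * L * 2 ≡ x * L * 2 + x * L * 2
    split = solve-∀
    regroup : ∀ x L y → L * 2 * suc y + x * L * 2 ≡ L * 2 * suc (y + x * 1)
    regroup = solve-∀

  sum-levels≤ : ∀ {n} a ls → (∀ b → 2 ^ b * #longer (threshold (2 ^ b)) ls ≤ n) →
                sum (map (levels a) ls) ≤ a * n
  sum-levels≤ zero ls few = ≤-reflexive (zeros ls)
    where
    zeros : ∀ ls → sum (map (levels 0) ls) ≡ 0
    zeros []       = refl
    zeros (_ ∷ ls) = zeros ls
  sum-levels≤ {n} (suc a) ls few = begin
    sum (map (levels (suc a)) ls)      ≡⟨ sum-map-+-* (levels a) (exceeds (threshold (2 ^ a))) (2 ^ a) ls ⟩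
    sum (map (levels a) ls) + 2 ^ a * #longer (threshold (2 ^ a)) ls ≤⟨ +-mono-≤ (sum-levels≤ a ls few) (few a) ⟩
    a * n + n                          ≡⟨ +-comm (a * n) n ⟩
    n + a * n                          ∎
    where open ≤-Reasoning

  sum-suc≤ : ∀ a ls → #longer (threshold (2 ^ a)) ls ≡ 0 →
             sum (map suc ls) ≤ length ls + L * 2 * (length ls + sum (map (levels a) ls))
  sum-suc≤ a []       none = z≤n
  sum-suc≤ a (ℓ ∷ ls) none = begin
    suc ℓ + sum (map suc ls)
      ≤⟨ +-mono-≤ (s≤s ℓ≤) (sum-suc≤ a ls (m+n≡0⇒n≡0 (exceeds (threshold (2 ^ a)) ℓ) none)) ⟩
    suc (L * 2 * suc (levels a ℓ)) + (length ls + L * 2 * (length ls + sum (map (levels a) ls)))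
      ≡⟨ regroup L (levels a ℓ) (length ls) (sum (map (levels a) ls)) ⟩
    suc (length ls) + L * 2 * (suc (length ls) + (levels a ℓ + sum (map (levels a) ls))) ∎
    where
    open ≤-Reasoning
    regroup : ∀ L x l s → suc (L * 2 * suc x) + (l + L * 2 * (l + s)) ≡ suc l + L * 2 * (suc l + (x + s))
    regroup = solve-∀
    b≮ℓ : ¬ threshold (2 ^ a) < ℓ
    b≮ℓ b<ℓ = contradiction (trans (sym (exceeds-yes b<ℓ)) (m+n≡0⇒m≡0 _ none)) λ ()
    ℓ≤ : ℓ ≤ L * 2 * suc (levels a ℓ)
    ℓ≤ = ≤-trans (≤-reflexive (sym (m≤n⇒m⊓n≡m (≮⇒≥ b≮ℓ)))) (⊓-threshold≤levels a ℓ)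

  -- No length exceeds the threshold of `2 ^ L`, since already one would give `2 ^ L ≤ n`. Each of
  -- the `L` lower scales contributes at most `n` to the sum of `levels`.
  sum-suc≤n+2L[n+Ln] : ∀ {n} ls → n < 2 ^ L → length ls ≤ n →
    (∀ q .{{_ : NonZero q}} → q * #longer (threshold q) ls ≤ n) →
    sum (map suc ls) ≤ n + L * 2 * (n + L * n)
  sum-suc≤n+2L[n+Ln] {n} ls n<2^L ∣ls∣≤n few =
    ≤-trans (sum-suc≤ L ls (none _ (few (2 ^ L) {{m^n≢0 2 L}})))
      (+-mono-≤ ∣ls∣≤n (*-monoʳ-≤ (L * 2) (+-mono-≤ ∣ls∣≤n (sum-levels≤ L ls λ b → few (2 ^ b) {{m^n≢0 2 b}}))))
    where
    none : ∀ c → 2 ^ L * c ≤ n → c ≡ 0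
    none zero    _  = refl
    none (suc c) le = contradiction n<2^L (≤⇒≯ (≤-trans (m≤m*n (2 ^ L) (suc c)) le))

-- The invariant along a run

Δ-Δ-⊆ : ∀ {m} (A B : Subset m) → A Δ (A Δ B) ⊆ B
Δ-Δ-⊆ A B {z} z∈ with ∈-Δ⁻ {A = A} {A Δ B} z∈
... | inj₁ (z∈A , z∉Δ) with z ∈? B
...   | yes z∈B = z∈B
...   | no z∉B  = contradiction (∈-Δ⁺ {A = A} (inj₁ (z∈A , z∉B))) z∉Δ
Δ-Δ-⊆ A B {z} z∈ | inj₂ (z∈Δ , z∉A) with ∈-Δ⁻ {A = A} {B} z∈Δ
... | inj₁ (z∈A , _) = contradiction z∈A z∉A
... | inj₂ (z∈B , _) = z∈B

∣AΔA∣≡0 : ∀ {m} (A : Subset m) → ∣ A Δ A ∣ ≡ 0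
∣AΔA∣≡0 {m} A = trans (cong ∣_∣ (Empty-unique empty)) (∣⊥∣≡0 m)
  where
  empty : ¬ (∃ λ z → z ∈ A Δ A)
  empty (z , z∈) with ∈-Δ⁻ {A = A} {A} z∈
  ... | inj₁ (z∈A , z∉A) = z∉A z∈A
  ... | inj₂ (z∈A , z∉A) = z∉A z∈A

module Run {m k} {M : Matroid m} {part : Fin m → Fin k} (r : SAPRun M part)
           (indep? : Decidable (Indep M))
           (walk? : ∀ i u → Dec (∃ (WalkToFree M part i (sets r (toℕ i)) u)))
           {n} (common≤n : ∀ A → CommonIndep M part A → ∣ A ∣ ≤ n)
           (L : ℕ) (1≤L : 1 ≤ L) (n<2^L : n < 2 ^ L) where

  open MatroidTheory M indep?
  open Dyadic L

  -- With `q = suc p`, some `S` certifies that `Φ_q` is at least `q` times the number of long paths;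
  -- the rank term is moved across to stay within `ℕ`.
  Potential : ℕ → List ℕ → Subset m → Set
  Potential p lens I = ∃ λ S → PartClosed part S ×
    suc p * #longer (threshold (suc p)) lens + p * rank S ≤ suc p * ∣ S ∩ I ∣

  -- `lens` lists the lengths of the augmenting paths used so far.
  record State (t : ℕ) : Set where
    field
      sound     : Sound M part t (sets r t)
      lens      : List ℕ
      cost      : reassignments r t ≤ sum (map suc lens)
      few       : length lens ≤ ∣ sets r t ∣
      potential : ∀ p → Potential p lens (sets r t)

  initial : State 0
  initial = record
    { sound     = subst (Sound M part 0) (sym (start r)) (record
      { indep      = indep-∅ M
      ; pindep     = λ x y x∈⊥ → contradiction x∈⊥ ∉⊥
      ; early      = λ x∈⊥ → contradiction x∈⊥ ∉⊥
      ; dead       = ⊥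
      ; dead-unhit = λ ()
      ; dead-span  = λ x∈⊥ → contradiction x∈⊥ ∉⊥
      ; dead-mate  = λ y∈⊥ → contradiction y∈⊥ ∉⊥
      })
    ; lens      = []
    ; cost      = z≤n
    ; few       = z≤n
    ; potential = λ p → ⊥ , (λ x y x∈⊥ → contradiction x∈⊥ ∉⊥) , (begin
        suc p * 0 + p * rank ⊥          ≡⟨ cong (_+ p * rank ⊥) (*-zeroʳ (suc p)) ⟩
        p * rank ⊥                      ≤⟨ *-monoʳ-≤ p rank⊥≤0 ⟩
        p * 0                           ≡⟨ *-zeroʳ p ⟩
        0                               ≤⟨ z≤n ⟩
        suc p * ∣ ⊥ ∩ sets r 0 ∣        ∎)
    }
    where
    open ≤-Reasoning hiding (start)
    rank⊥≤0 : rank ⊥ ≤ 0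
    rank⊥≤0 = ≤-trans (p⊆q⇒∣p∣≤∣q∣ (proj₂ (proj₁ (proj₂ (basis ⊥))))) (≤-reflexive (∣⊥∣≡0 m))

  blocked : ∀ i → State (toℕ i) →
            ¬ (∃ λ v → ∃ λ vs → AugPath M part i (sets r (toℕ i)) v vs) →
            sets r (suc (toℕ i)) ≡ sets r (toℕ i) → State (suc (toℕ i))
  blocked i state ¬aug I′≡I = record
    { sound     = subst (Sound M part (suc (toℕ i))) (sym I′≡I) (blocked-sound (walk? i) ¬aug)
    ; lens      = lens
    ; cost      = ≤-trans (≤-reflexive (trans (cong (reassignments r (toℕ i) +_) unchanged) (+-identityʳ _))) cost
    ; few       = subst (λ I′ → length lens ≤ ∣ I′ ∣) (sym I′≡I) few
    ; potential = λ p → subst (Potential p lens) (sym I′≡I) (potential p)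
    }
    where
    open State state
    open ExchangeGraph M indep? part i (sets r (toℕ i)) sound
    unchanged : ∣ sets r (toℕ i) Δ sets r (suc (toℕ i)) ∣ ≡ 0
    unchanged = trans (cong (λ I′ → ∣ sets r (toℕ i) Δ I′ ∣) I′≡I) (∣AΔA∣≡0 (sets r (toℕ i)))

  module Augment {i : Fin k} (state : State (toℕ i)) {v vs}
                 (shortest-aug : ShortestAugPath M part i (sets r (toℕ i)) v vs) where

    open State state
    open Sound sound

    private
      I = sets r (toℕ i)
      I′ = I Δ vertexSet M part i I v vs
      pv≡i = proj₁ (proj₁ shortest-aug)
      shortest = proj₂ shortest-aug

    open ExchangeGraph M indep? part i I sound

    geo : Geodesic v vs
    geo = proj₂ (proj₁ shortest-aug) ,
      walks-long⇒far (length vs) (λ ws walk′ → shortest v ws (pv≡i , walk′)) , shortest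

    cost′ : ∣ I Δ I′ ∣ ≤ suc (length vs)
    cost′ = ≤-trans (p⊆q⇒∣p∣≤∣q∣ (Δ-Δ-⊆ I _)) (∣vertices∣≤ v vs)

    few′ : suc (length lens) ≤ ∣ I′ ∣
    few′ = begin
      suc (length lens)    ≤⟨ s≤s few ⟩
      suc ∣ I ∣            ≡⟨ cong (λ J → suc ∣ J ∣) (∩-identityˡ I) ⟨
      suc ∣ full ∩ I ∣     ≤⟨ proj₂ (augment-∣∩∣ pv≡i geo {full} (λ _ _ _ _ → ∈⊤)) ∈⊤ ⟩
      ∣ full ∩ I′ ∣        ≡⟨ cong ∣_∣ (∩-identityˡ I′) ⟩
      ∣ I′ ∣               ∎
      where open ≤-Reasoning

    potential-short : ∀ p → ¬ threshold (suc p) < length vs → Potential p (length vs ∷ lens) I′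
    potential-short p ¬long = S , closed , (begin
      suc p * (exceeds (threshold (suc p)) (length vs) + N) + p * rank S
        ≡⟨ cong (λ e → suc p * (e + N) + p * rank S) (exceeds-no ¬long) ⟩
      suc p * N + p * rank S
        ≤⟨ proj₂ (proj₂ (potential p)) ⟩
      suc p * ∣ S ∩ I ∣
        ≤⟨ *-monoʳ-≤ (suc p) (proj₁ (augment-∣∩∣ pv≡i geo closed)) ⟩
      suc p * ∣ S ∩ I′ ∣ ∎)
      where
      open ≤-Reasoning
      N = #longer (threshold (suc p)) lens
      S = proj₁ (potential p)
      closed = proj₁ (proj₂ (potential p))

    -- The old witness `S` is replaced by a maximiser `T`, whose excess is no smaller. Since `T`
    -- spans the new part, adding that part to get `U` leaves the rank bounded by `rank T`, while
    -- `v` adds one element; the excess rises by `suc p`, which pays for the new long path.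
    potential-long : ∀ p → threshold (suc p) < length vs → Potential p (length vs ∷ lens) I′
    potential-long p long = U , U-closed , (begin
      suc p * (exceeds (threshold (suc p)) (length vs) + N) + p * rank U
        ≡⟨ cong (λ e → suc p * (e + N) + p * rank U) (exceeds-yes long) ⟩
      suc p * suc N + p * rank U        ≤⟨ +-monoʳ-≤ (suc p * suc N) (*-monoʳ-≤ p (spanned⇒rank≤ U-spanned)) ⟩
      suc p * suc N + p * rank T        ≡⟨ regroup (suc p) N (p * rank T) ⟩
      suc p + (suc p * N + p * rank T)  ≤⟨ +-monoʳ-≤ (suc p) excess-T ⟩
      suc p + suc p * ∣ T ∩ I ∣         ≡⟨ *-suc (suc p) (∣ T ∩ I ∣) ⟨
      suc p * suc ∣ T ∩ I ∣             ≤⟨ *-monoʳ-≤ (suc p) (≤-trans (s≤s T∩I≤U∩I) (proj₂ (augment-∣∩∣ pv≡i geo U-closed) v∈U)) ⟩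
      suc p * ∣ U ∩ I′ ∣                ∎)
      where
      open ≤-Reasoning
      S = proj₁ (potential p)
      closed = proj₁ (proj₂ (potential p))
      bound = proj₂ (proj₂ (potential p))
      T = proj₁ (maximal p)
      T-max : Maximal p T
      T-max = proj₂ (maximal p)
      T-closed = proj₁ T-max
      T-best = proj₂ T-max
      N = #longer (threshold (suc p)) lens
      regroup : ∀ q N x → q * suc N + x ≡ q + (q * N + x)
      regroup = solve-∀
      new? : Decidable (λ x → part x ≡ i)
      new? x = part x ≟F i
      U = T ∪ comprehension new?
      v∈U : v ∈ U
      v∈U = q⊆p∪q T _ (∈-comprehension⁺ new? pv≡i)
      U-closed : PartClosed part U
      U-closed x y x∈U px≡py with x∈p∪q⁻ T _ x∈U
      ... | inj₁ x∈T = p⊆p∪q _ (T-closed x y x∈T px≡py)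
      ... | inj₂ x∈  = q⊆p∪q T _ (∈-comprehension⁺ new? (trans (sym px≡py) (∈-comprehension⁻ new? x∈)))
      U-spanned : ∀ {x} → x ∈ U → Spanned T x
      U-spanned {x} x∈U with x∈p∪q⁻ T _ x∈U
      ... | inj₁ x∈T = inj₁ x∈T
      ... | inj₂ x∈  = far⇒spanned-by-maximal T-max (suc p * L) (common≤n I (indep , pindep))
        (^-growth p L 1≤L n<2^L) (≤-reflexive (cong toℕ px≡i)) (new⇒∉I px≡i)
        -- The path is shortest among those from all elements of the new part, so each such `x` is
        -- as far as `v`. The strict inequality in `long` supplies the extra arc from `x` before the
        -- double steps.
        (far-mono long (walks-long⇒far (length vs) λ ws walk′ → shortest x ws (px≡i , walk′)))
        where
        px≡i = ∈-comprehension⁻ new? x∈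
      T∩I≤U∩I : ∣ T ∩ I ∣ ≤ ∣ U ∩ I ∣
      T∩I≤U∩I = p⊆q⇒∣p∣≤∣q∣ {p = T ∩ I} {q = U ∩ I} λ z∈ → case x∈p∩q⁻ T I z∈ of λ
        { (z∈T , z∈I) → x∈p∩q⁺ (p⊆p∪q _ z∈T , z∈I) }
      excess-T : suc p * N + p * rank T ≤ suc p * ∣ T ∩ I ∣
      excess-T = +-cancelʳ-≤ (p * rank S) _ _ (begin
        suc p * N + p * rank T + p * rank S      ≡⟨ swap (suc p * N) (p * rank T) (p * rank S) ⟩
        suc p * N + p * rank S + p * rank T      ≤⟨ +-monoˡ-≤ (p * rank T) bound ⟩
        suc p * ∣ S ∩ I ∣ + p * rank T           ≤⟨ T-best S closed ⟩
        suc p * ∣ T ∩ I ∣ + p * rank S           ∎)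
        where
        swap : ∀ a b c → a + b + c ≡ a + c + b
        swap = solve-∀

    potential′ : ∀ p → Potential p (length vs ∷ lens) I′
    potential′ p = [ potential-long p , potential-short p ]′ (toSum (threshold (suc p) <? length vs))

  augmented : ∀ i → State (toℕ i) → ∀ {v vs} → ShortestAugPath M part i (sets r (toℕ i)) v vs →
              sets r (suc (toℕ i)) ≡ sets r (toℕ i) Δ vertexSet M part i (sets r (toℕ i)) v vs →
              State (suc (toℕ i))
  augmented i state {v} {vs} aug I′≡IΔV = record
    { sound     = subst (Sound M part (suc (toℕ i))) (sym I′≡IΔV) (augment-sound pv≡i geo)
    ; lens      = length vs ∷ lens
    ; cost      = ≤-trans
        (+-mono-≤ cost (subst (λ I′ → ∣ sets r (toℕ i) Δ I′ ∣ ≤ suc (length vs)) (sym I′≡IΔV) cost′))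
        (≤-reflexive (+-comm (sum (map suc lens)) (suc (length vs))))
    ; few       = subst (λ I′ → suc (length lens) ≤ ∣ I′ ∣) (sym I′≡IΔV) few′
    ; potential = λ p → subst (Potential p (length vs ∷ lens)) (sym I′≡IΔV) (potential′ p)
    }
    where
    open State state
    open ExchangeGraph M indep? part i (sets r (toℕ i)) sound
    open Augment state aug
    pv≡i = proj₁ (proj₁ aug)

  advance : ∀ i → State (toℕ i) → State (suc (toℕ i))
  advance i state with step r i
  ... | inj₁ (v , vs , aug , I′≡IΔV) = augmented i state aug I′≡IΔV
  ... | inj₂ (¬aug , I′≡I)           = blocked i state ¬aug I′≡I

  state : ∀ t → t ≤ k → State t
  state zero    _   = initial
  state (suc t) t<k = subst (State ∘ suc) (toℕ-fromℕ< t<k)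
    (advance (fromℕ< t<k) (subst State (sym (toℕ-fromℕ< t<k)) (state t (<⇒≤ t<k))))

  totalReassignments≤ : totalReassignments r ≤ n + L * 2 * (n + L * n)
  totalReassignments≤ = ≤-trans cost (sum-suc≤n+2L[n+Ln] lens n<2^L (≤-trans few I≤n) few-long)
    where
    open State (state k ≤-refl)
    open Sound sound
    I = sets r k
    I≤n : ∣ I ∣ ≤ n
    I≤n = common≤n I (indep , pindep)
    -- Independence of `S ∩ I` bounds `rank S` from below, so the excess of `S` is at most
    -- `∣ S ∩ I ∣`.
    few-long : ∀ q .{{_ : NonZero q}} → q * #longer (threshold q) lens ≤ n
    few-long (suc p) with potential p
    ... | S , _ , bound = ≤-trans (+-cancelʳ-≤ (p * ∣ S ∩ I ∣) _ _ (begin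
      suc p * #longer (threshold (suc p)) lens + p * ∣ S ∩ I ∣
        ≤⟨ +-monoʳ-≤ (suc p * #longer (threshold (suc p)) lens) (*-monoʳ-≤ p S∩I≤rank) ⟩
      suc p * #longer (threshold (suc p)) lens + p * rank S
        ≤⟨ bound ⟩
      ∣ S ∩ I ∣ + p * ∣ S ∩ I ∣ ∎))
      (≤-trans (∣p∩q∣≤∣q∣ S I) I≤n)
      where
      open ≤-Reasoning
      S∩I≤rank : ∣ S ∩ I ∣ ≤ rank S
      S∩I≤rank = indep⇒≤rank (indep-⊆ M (p∩q⊆q S I) indep) (p∩q⊆p S I)

-- The final bound

n<2^[1+⌈log₂n⌉] : ∀ n → n < 2 ^ suc ⌈log₂ n ⌉
n<2^[1+⌈log₂n⌉] n with n <? 2 ^ suc ⌈log₂ n ⌉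
... | yes n< = n<
... | no n≮  = contradiction
  (≤-trans (≤-reflexive (sym (⌈log₂2^n⌉≡n (suc ⌈log₂ n ⌉)))) (⌈log₂⌉-mono-≤ (≮⇒≥ n≮))) (<⇒≱ ≤-refl)

-- Both sides equal `13 * n` at `l = 1`, which fixes the constant. With `l = j + 1`, the terms
-- `16 * j * n + 11 * j * j * n` are the exact slack.
n+2L[n+Ln]≤13nl² : ∀ n l → 1 ≤ l → n + suc l * 2 * (n + suc l * n) ≤ 13 * (n * (l * l))
n+2L[n+Ln]≤13nl² n (suc j) _ = ≤-trans (m≤m+n _ (16 * j * n + 11 * j * j * n)) (≤-reflexive (expand n j))
  where
  expand : ∀ n j → n + (2 + j) * 2 * (n + (2 + j) * n) + (16 * j * n + 11 * j * j * n)
                 ≡ 13 * (n * ((1 + j) * (1 + j)))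
  expand = solve-∀

mainTheorem1 : ∃ λ (C : ℕ) → ∃ λ (n₀ : ℕ) →
    ∀ (m k : ℕ) (M : Matroid m) (part : Fin m → Fin k) (n : ℕ) →
    IsIntersectionRank M part n → n₀ ≤ n →
    (r : SAPRun M part) →
    totalReassignments r ≤ C * (n * (⌈log₂ n ⌉ * ⌈log₂ n ⌉))
-- From `n = 2` on, `⌈log₂ n ⌉` is at least `1`, as the final estimate requires.
mainTheorem1 = 13 , 2 , λ m k M part n (_ , common≤n) 2≤n r →
  decidable-stable (_ ≤? _) λ ≰ →
  ¬¬-Subset (λ _ → ¬¬-excluded-middle) λ indep? →
  sequence ¬¬.rawApplicative (λ i → sequence ¬¬.rawApplicative (λ u → ¬¬-excluded-middle)) λ walk? →
  ≰ (≤-trans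
    (Run.totalReassignments≤ r indep? walk? common≤n (suc ⌈log₂ n ⌉) (s≤s z≤n) (n<2^[1+⌈log₂n⌉] n))
    (n+2L[n+Ln]≤13nl² n ⌈log₂ n ⌉ (⌈log₂⌉-mono-≤ 2≤n)))
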